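{- Let $p$ be a prime and let $\mathsf{X}$ be a finite connected graph without tails, equipped with the data of a branched $\mathbb{Z}_p$-tower $(\mathsf{X}_n)_{n\ge 0}$ arising from the trivial voltage assignment ($\alpha(e)=1$ for every directed edge $e$), such that every $\mathsf{X}_n$ is connected. Let $l$ be the number of ramified vertices of $\mathsf{X}$ and assume that every ramified vertex is totally ramified. Suppose that $\mathsf{X}$ has a segment decomposition with segments $\mathsf{S}^1,\dots,\mathsf{S}^k$, where $\mathsf{S}^i$ is a $t_i$-segment ($t_i\in\{1,2\}$). Then for every $n\ge 0$, \[ \kappa(\mathsf{X}_n)=\kappa(\mathsf{X})\cdot p^{n(l-1)}\prod_{i=1}^{k}F_{t_i}(\mathsf{S}^i)^{p^n-1}. \]
   Context: Graphs: a graph $\mathsf{X}$ has a finite vertex set, a set of directed edges, origin/terminus maps $o,t$ and a fixed-point-free involution $e\mapsto\bar e$ with $o(\bar e)=t(e)$, $t(\bar e)=o(e)$; undirected edges are the pairs $\{e,\bar e\}$. Multiple edges and loops are allowed. $\kappa(\mathsf{Y})$ denotes the number of spanning trees of a graph $\mathsf{Y}$. Some vertices are designated ramified (marked); the others are unramified. $\mathsf{X}$ has no tails means: no unramified vertex has exactly one neighbour and is joined to it by exactly one edge. Segments: a path is a sequence of distinct vertices $w_0,\dots,w_m$ together with distinct undirected edges joining $w_{j-1}$ and $w_j$. An admissible path is a path whose two endpoints are distinct ramified vertices and whose interior vertices are all unramified. For each unordered pair $\{v,v'\}$ of distinct ramified vertices joined by at least one admissible path, partition the admissible paths between $v$ and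 $v'$ into classes under the equivalence relation generated by "have an edge in common"; the subgraph formed by all vertices and edges of the paths of one class is a 2-segment (its ramified vertices are $v,v'$). $\mathsf{X}$ has a segment decomposition if (a) no two admissible paths joining different pairs of distinct ramified vertices have an edge in common, and (b) every edge lying in no 2-segment lies on a closed path at some ramified vertex $v$ (a closed sequence $v=w_0,w_1,\dots,w_m=v$, $m\ge1$, with distinct edges, whose vertices $w_1,\dots,w_{m-1}$ are distinct, unramified and belong to no 2-segment). For each ramified $v$, such closed paths at $v$ are grouped into classes by the equivalence relation generated by sharing an edge, and each class gives a subgraph called a 1-segment (its only ramified vertex is $v$). The segments of the decomposition are all 1- and 2-segments; their edge sets partition the edges of $\mathsf{X}$. A $t$-segment is regarded as a graph with its $t$ ramified vertices marked. Segmental forests: for a graph $\mathsf{S}$ with $t\in\{1,2\}$ marked vertices, a segmental $t$-tree spanning forest is a spanning subgraph which is a forest with exactly $t$ connected components, each containing exactly one marked vertex; $F_t(\mathsf{S})$ is their number (so $F_1(\mathsf{S})=\kappa(\mathsf{S})$). $\mathbb{Z}_p$-towers: let $\Gamma\cong\mathbb{Z}_p$ (written multiplicatively), $\Gamma_n=\Gamma/\Gamma^{p^n}$, $\pi_n:\Gamma\to\Gamma_n$. A voltage assignment is a map $\alpha$ from directed edges to $\Gamma$ with $\alpha(\bar e)=\alpha(e)^{ -1}$; for each vertex $v$ a closed subgroup $I_v\subseteq\Gamma$ is fixed. $\mathsf{X}_n$ has vertex set $\bigsqcup_v\{v\}\times\Gamma_n/\pi_n(I_v)$ and directed edges $(e,g)$,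 $e$ a directed edge of $\mathsf{X}$, $g\in\Gamma_n$, where $(e,g)$ goes from $(o(e),g\pi_n(I_{o(e)}))$ to $(t(e),g\pi_n(\alpha(e))\pi_n(I_{t(e)}))$ and $\overline{(e,g)}=(\bar e,g\pi_n(\alpha(e)))$; $\mathsf{X}_0=\mathsf{X}$. A vertex $v$ is ramified if $I_v\neq 1$, unramified if $I_v=1$, totally ramified if $I_v=\Gamma$. The ramified vertices of $\mathsf{X}$ in this sense are the ones used to define the segments. -}

module Defs where

open import Data.Nat using (ℕ; zero; suc; _+_; _*_; _∸_; _^_; _⊓_; NonZero)
open import Data.Nat.Properties using (m^n≢0)
open import Data.Nat.DivMod using (_mod_)
open import Data.Nat.Primality using (Prime; prime⇒nonZero)
open import Data.Fin using (Fin; zero; suc; toℕ; remQuot; combine)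
open import Data.Fin.Subset using (Subset; _∈_)
open import Data.List using (List; []; _∷_; length; map)
open import Data.List.Relation.Unary.All using (All)
open import Data.List.Relation.Unary.Any using (Any)
open import Data.List.Relation.Unary.AllPairs using (AllPairs)
import Data.List.Membership.Propositional as LMem
open import Data.List.Relation.Unary.Unique.Propositional using (Unique)
open import Data.Product using (Σ; ∃; _×_; _,_; proj₁; proj₂)
open import Data.Sum using (_⊎_)
open import Relation.Nullary using (¬_)
open import Relation.Binary.PropositionalEquality using (_≡_; _≢_)
open import Relation.Binary.Construct.Closure.ReflexiveTransitive using (Star)

IsCount : {A : Set} → (A → Set) → ℕ → Set
IsCount {A} P k =
  Σ (List A) λ xs → Unique xs × length xs ≡ k
                    × (∀ x → (x LMem.∈ xs → P x) × (P x → x LMem.∈ xs))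

prodFin : (k : ℕ) → (Fin k → ℕ) → ℕ
prodFin zero    f = 1
prodFin (suc k) f = f zero * prodFin k (λ i → f (suc i))

record PreGraph : Set₁ where
  field
    Vtx : Set
    nE  : ℕ
    o   : Fin nE → Vtx
    t   : Fin nE → Vtx
    bar : Fin nE → Fin nE

record FinGraph (V E : ℕ) : Set where
  field
    o   : Fin E → Fin V
    t   : Fin E → Fin V
    bar : Fin E → Fin E

record IsGraph {V E : ℕ} (X : FinGraph V E) : Set where
  open FinGraph X
  field
    bar-invol : ∀ e → bar (bar e) ≡ e
    bar-fpf   : ∀ e → bar e ≢ e
    o-bar     : ∀ e → o (bar e) ≡ t e

toPre : {V E : ℕ} → FinGraph V E → PreGraph
toPre {V} {E} X = record { Vtx = Fin V ; nE = E ; o = FinGraph.o X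
                         ; t = FinGraph.t X ; bar = FinGraph.bar X }

module _ (G : PreGraph) where
  open PreGraph G

  Edge : Set
  Edge = Fin nE

  Chain : Vtx → List Edge → Vtx → Set
  Chain u []       v = u ≡ v
  Chain u (e ∷ es) v = o e ≡ u × Chain (t e) es v

  interior : List Edge → List Vtx
  interior []             = []
  interior (e ∷ [])       = []
  interior (e ∷ f ∷ es)   = t e ∷ interior (f ∷ es)

  verts : Vtx → List Edge → List Vtx
  verts u es = u ∷ map t es

  UndirDistinct : List Edge → Set
  UndirDistinct = AllPairs (λ a b → a ≢ b × a ≢ bar b)

  EdgeOn : Edge → List Edge → Set
  EdgeOn e es = Any (λ f → f ≡ e ⊎ f ≡ bar e) es

  VertOn : Vtx → List Edge → Set
  VertOn w es = Any (λ f → o f ≡ w ⊎ t f ≡ w) es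

  ShareEdge : List Edge → List Edge → Set
  ShareEdge es fs = Any (λ e → EdgeOn e fs) es

  -- Edge subsets (subgraphs); an undirected edge set is a set of
  -- directed edges closed under e ↦ ē.

  BarClosed : Subset nE → Set
  BarClosed S = ∀ e → e ∈ S → bar e ∈ S

  WalkIn : Subset nE → Vtx → Vtx → Set
  WalkIn S u v = ∃ λ es → Chain u es v × All (_∈ S) es

  ConnectedIn : Subset nE → Set
  ConnectedIn S = ∀ u v → WalkIn S u v

  HasCycleIn : Subset nE → Set
  HasCycleIn S = Σ Vtx λ u → Σ Edge λ e → Σ (List Edge) λ es →
                   Chain u (e ∷ es) u × All (_∈ S) (e ∷ es) × UndirDistinct (e ∷ es)

  AcyclicIn : Subset nE → Set
  AcyclicIn S = ¬ HasCycleIn S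

  SpanningTree : Subset nE → Set
  SpanningTree S = BarClosed S × ConnectedIn S × AcyclicIn S

  GraphConnected : Set
  GraphConnected = Vtx × (∀ u v → ∃ λ es → Chain u es v)

  module Segments (ram : Vtx → Set) where

    PathFromTo : Vtx → List Edge → Vtx → Set
    PathFromTo a es b = Chain a es b × Unique (verts a es)

    Adm : Vtx → Vtx → List Edge → Set
    Adm a b es = PathFromTo a es b × a ≢ b × ram a × ram b
                 × All (λ w → ¬ ram w) (interior es)

    AdmPair : Vtx → Vtx → List Edge → Set
    AdmPair v v' es = Adm v v' es ⊎ Adm v' v es

    Linked2 : Vtx → Vtx → List Edge → List Edge → Set
    Linked2 v v' = Star (λ P Q → AdmPair v v' P × AdmPair v v' Q × ShareEdge P Q)

    VertIn2Seg : Vtx → Set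
    VertIn2Seg w = Σ Vtx λ a → Σ Vtx λ b → Σ (List Edge) λ es →
                     Adm a b es × VertOn w es
    EdgeIn2Seg : Edge → Set
    EdgeIn2Seg e = Σ Vtx λ a → Σ Vtx λ b → Σ (List Edge) λ es →
                     Adm a b es × EdgeOn e es

    ClosedAt : Vtx → List Edge → Set
    ClosedAt v es = ram v × Σ Edge (λ e → Σ (List Edge) λ fs → es ≡ e ∷ fs)
                    × Chain v es v × UndirDistinct es
                    × Unique (interior es)
                    × All (λ w → ¬ ram w × ¬ VertIn2Seg w) (interior es)

    Linked1 : Vtx → List Edge → List Edge → Set
    Linked1 v = Star (λ P Q → ClosedAt v P × ClosedAt v Q × ShareEdge P Q)

    CondA : Set
    CondA = ∀ a b es a' b' es' → Adm a b es → Adm a' b' es' → ShareEdge es es'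
            → (a ≡ a' × b ≡ b') ⊎ (a ≡ b' × b ≡ a')

    CondB : Set
    CondB = ∀ e → ¬ EdgeIn2Seg e → Σ Vtx λ v → Σ (List Edge) λ es →
              ClosedAt v es × EdgeOn e es

    -- a segment, given by a representative path of its class
    data SegRep : Set where
      seg2 : Vtx → Vtx → List Edge → SegRep
      seg1 : Vtx → List Edge → SegRep

    ValidRep : SegRep → Set
    ValidRep (seg2 v v' P) = Adm v v' P
    ValidRep (seg1 v C)    = ClosedAt v C

    InClass : SegRep → List Edge → Set
    InClass (seg2 v v' P) Q = AdmPair v v' Q × Linked2 v v' P Q
    InClass (seg1 v C)    Q = ClosedAt v Q × Linked1 v C Q

    segT : SegRep → ℕ
    segT (seg2 _ _ _) = 2
    segT (seg1 _ _)   = 1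

    Marked : SegRep → Vtx → Set
    Marked (seg2 v v' _) w = w ≡ v ⊎ w ≡ v'
    Marked (seg1 v _)    w = w ≡ v

    SegEdge : SegRep → Edge → Set
    SegEdge r e = Σ (List Edge) λ Q → InClass r Q × EdgeOn e Q
    SegVert : SegRep → Vtx → Set
    SegVert r w = Σ (List Edge) λ Q → InClass r Q × VertOn w Q

    -- F is (the edge set of) a segmental t-tree spanning forest of the
    -- segment r: a forest inside the segment, spanning its vertices,
    -- each component containing exactly one marked vertex.
    SegForest : SegRep → Subset nE → Set
    SegForest r F = (∀ e → e ∈ F → SegEdge r e) × BarClosed F × AcyclicIn F
                    × (∀ w → SegVert r w → Σ Vtx λ m → Marked r m × WalkIn F w m)
                    × (∀ m m' → Marked r m → Marked r m' → WalkIn F m m' → m ≡ m')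

    record SegDecomp : Set where
      field
        k        : ℕ
        seg      : Fin k → SegRep
        valid    : ∀ i → ValidRep (seg i)
        condA    : CondA
        condB    : CondB
        cover2   : ∀ a b Q → Adm a b Q → Σ (Fin k) λ i → InClass (seg i) Q
        cover1   : ∀ v Q → ClosedAt v Q → Σ (Fin k) λ i → InClass (seg i) Q
        distinct : ∀ i j Q → InClass (seg i) Q → InClass (seg j) Q → i ≡ j

  NoTails : (Vtx → Set) → Set
  NoTails ram = ∀ v → ¬ ram v → ¬ (Σ Edge λ e → o e ≡ v × t e ≢ v
                                      × (∀ e' → o e' ≡ v → e' ≡ e))

-- Closed subgroups of Γ ≅ ℤ_p: the trivial subgroup, or Γ^{p^m} = p^m ℤ_p.

data CSub : Set where
  triv : CSub
  pPow : ℕ → CSub      -- pPow m = Γ^{p^m};  pPow 0 = Γ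

Ramified : CSub → Set
Ramified I = I ≢ triv

TotallyRamified : CSub → Set
TotallyRamified I = I ≡ pPow 0

-- Γₙ = ℤ/pⁿ;  |Γₙ / πₙ(I)|
cosetSize : ℕ → ℕ → CSub → ℕ
cosetSize p n triv     = p ^ n
cosetSize p n (pPow m) = p ^ (m ⊓ n)

-- the n-th layer Xₙ of the ℤ_p-tower attached to the trivial voltage
-- assignment (α(e) = 1) and inertia groups I_v.
-- Directed edges (e, g) ∈ E × Γₙ are encoded as combine e g ∈ Fin (E * pⁿ);
-- vertices (v, g πₙ(I_v)) with g πₙ(I_v) ∈ Γₙ/πₙ(I_v) ≅ ℤ/p^{cosetSize}.
module _ (p : ℕ) (pr : Prime p) where
  private instance
    nzp : NonZero p
    nzp = prime⇒nonZero pr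

  coset : (n : ℕ) (I : CSub) → Fin (p ^ n) → Fin (cosetSize p n I)
  coset n triv     g = _mod_ (toℕ g) (p ^ n) {{m^n≢0 p n}}
  coset n (pPow m) g = _mod_ (toℕ g) (p ^ (m ⊓ n)) {{m^n≢0 p (m ⊓ n)}}

  Layer : {V E : ℕ} → FinGraph V E → (Fin V → CSub) → ℕ → PreGraph
  Layer {V} {E} X I n = record
    { Vtx = Σ (Fin V) λ v → Fin (cosetSize p n (I v))
    ; nE  = E * p ^ n
    ; o   = λ x → let eg = remQuot (p ^ n) x ; e = proj₁ eg ; g = proj₂ eg
                  in (FinGraph.o X e , coset n (I (FinGraph.o X e)) g)
    ; t   = λ x → let eg = remQuot (p ^ n) x ; e = proj₁ eg ; g = proj₂ eg
                  in (FinGraph.t X e , coset n (I (FinGraph.t X e)) g)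
    ; bar = λ x → let eg = remQuot (p ^ n) x
                  in combine (FinGraph.bar X (proj₁ eg)) (proj₂ eg)
    }

{-# OPTIONS --safe #-}
-- Since the voltages are trivial and ramification is total, Xₙ consists of q = pⁿ
-- copies of X glued along the ramified vertices: each segment Sⁱ is replaced by q
-- parallel copies.  A spanning tree of Xₙ meets at most one copy of Sⁱ in a
-- subgraph joining the two marked vertices, and every other copy in a segmental
-- forest.  Selecting in each segment the joining copy (or a fixed copy when there
-- is none) gives a spanning tree of X.  Conversely a spanning tree T of X, a
-- choice of copy for every segment in which T joins the marked vertices, and
-- q − 1 segmental forests of every Sⁱ determine a spanning tree of Xₙ.  Contracting
-- segments turns T into a tree on the l ramified vertices, so exactly l − 1
-- segments are joined and the fibre over T has q^(l−1) ∏ Fᵢ^(q−1) elements.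
module Submission where

open import Defs
open import Data.Bool using (Bool; true; false; _∧_; _xor_; if_then_else_)
open import Data.Bool.Properties using (xor-assoc; xor-comm; xor-same; xor-identityʳ; ∧-zeroʳ; ∧-identityʳ)
open import Data.Nat using (ℕ; zero; suc; _+_; _*_; _∸_; _^_; _⊓_; _<_; s≤s; z≤n; NonZero)
import Data.Nat.Properties as ℕ
open import Data.Nat.DivMod using (_mod_; m<n⇒m%n≡m)
open import Data.Nat.Primality using (Prime; prime⇒nonZero; ¬prime[0]; ¬prime[1])
open import Data.Fin using (Fin; zero; suc; _≟_; toℕ; fromℕ<; inject≤; combine; remQuot)
open import Data.Fin.Properties using (remQuot-combine; combine-remQuot; combine-injective; any?; cantor-schröder-bernstein; toℕ-injective; toℕ-fromℕ<; toℕ-inject≤; toℕ<n)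
open import Data.Fin.Subset using (Subset; _∈_)
open import Data.Vec using (Vec; []; _∷_; lookup; tabulate)
open import Data.Vec.Properties using (lookup∘tabulate; tabulate∘lookup; tabulate-cong; []=⇒lookup; lookup⇒[]=)
open import Data.List as List using (List; []; _∷_; _++_; map)
open import Data.List.Relation.Unary.All as All using (All; []; _∷_)
import Data.List.Relation.Unary.All.Properties as All
open import Data.List.Relation.Unary.Any as Any using (Any; here; there)
import Data.List.Relation.Unary.Any.Properties as Any
open import Data.List.Relation.Unary.AllPairs as AllPairs using (AllPairs; []; _∷_)
import Data.List.Relation.Unary.AllPairs.Properties as AllPairs
open import Data.List.Relation.Unary.Unique.Propositional using (Unique)
import Data.List.Relation.Unary.Unique.Propositional.Properties as Unique
import Data.List.Membership.Propositional as LMem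
import Data.List.Membership.Propositional.Properties as LMem
import Data.List.Membership.DecPropositional as DecMem
open import Data.Product using (Σ; ∃; _×_; _,_; proj₁; proj₂; uncurry)
open import Data.Sum using (_⊎_; inj₁; inj₂; [_,_]′)
open import Data.Unit using (⊤; tt)
open import Data.Empty using (⊥; ⊥-elim)
open import Function using (_∘_; id)
open import Relation.Nullary using (¬_; Dec; yes; no)
open import Relation.Nullary.Decidable using (⌊_⌋; does; toSum; ¬?; _×-dec_; _⊎-dec_; decidable-stable; ¬¬-excluded-middle)
open import Relation.Binary.Definitions using (DecidableEquality; tri<; tri≈; tri>)
open import Relation.Binary.Construct.Closure.ReflexiveTransitive using (_◅◅_; _◅_; ε)
open import Relation.Binary.PropositionalEquality using (_≡_; _≢_; refl; sym; trans; cong; cong₂; subst; subst₂)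

-- The classes of paths are generated by shared edges, but gluing copies requires more: distinct
-- segments may meet only in ramified vertices. This is proved by splicing two paths at a common
-- unramified vertex; the count then uses only the resulting labelling of edges by segments.
-- Spanning trees of X and of the cover are compared through an explicit section and retraction
-- rather than by counting edges. Connectedness is transported along images of walks, and a cycle
-- either maps to a cycle or is contracted entirely, which confines it to the forests. The
-- contracted tree on the ramified vertices is never formed. For a spanning tree T, deleting the
-- T-edges of a joined segment gives a cut that separates its two marks. Over 𝔽₂ these cuts are dual
-- to the joined segments, so counting functions on the ramified vertices gives 2^l = 2 · 2^(number
-- of joined segments). Walks and 2-segments are not decided by a search: an equality of natural
-- numbers may be proved under a double negation, where excluded middle is available for the
-- finitely many instances needed.

¬¬-Fin : ∀ {n} {P : Fin n → Set} → (∀ i → ¬ ¬ P i) → ¬ ¬ (∀ i → P i)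
¬¬-Fin {zero}  f c = c λ ()
¬¬-Fin {suc n} f c = f zero λ p₀ → ¬¬-Fin (f ∘ suc) λ ps →
  c λ { zero → p₀ ; (suc i) → ps i }

¬¬-Subset : ∀ {n} {P : Subset n → Set} → (∀ S → ¬ ¬ P S) → ¬ ¬ (∀ S → P S)
¬¬-Subset {zero}  f c = f [] λ p → c λ { [] → p }
¬¬-Subset {suc n} f c =
  ¬¬-Subset (f ∘ (true ∷_)) λ p → ¬¬-Subset (f ∘ (false ∷_)) λ p′ →
  c λ { (true ∷ S) → p S ; (false ∷ S) → p′ S }

∈-tabulate⁺ : ∀ {n} {f : Fin n → Bool} {i} → f i ≡ true → i ∈ tabulate f
∈-tabulate⁺ {f = f} {i} eq = lookup⇒[]= i _ (trans (lookup∘tabulate f i) eq)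

∈-tabulate⁻ : ∀ {n} {f : Fin n → Bool} {i} → i ∈ tabulate f → f i ≡ true
∈-tabulate⁻ {f = f} {i} i∈ = trans (sym (lookup∘tabulate f i)) ([]=⇒lookup i∈)

≡true-iff : ∀ {x y : Bool} → (x ≡ true → y ≡ true) → (y ≡ true → x ≡ true) → x ≡ y
≡true-iff {true}  {y}     f g = sym (f refl)
≡true-iff {false} {false} f g = refl
≡true-iff {false} {true}  f g = g refl

∧-true⁻ : ∀ {x y} → x ∧ y ≡ true → x ≡ true × y ≡ true
∧-true⁻ {true} {true} _ = refl , refl

module _ {A : Set} where
  ⌊⌋-true⁺ : (d : Dec A) → A → ⌊ d ⌋ ≡ true
  ⌊⌋-true⁺ (yes _) _ = refl
  ⌊⌋-true⁺ (no ¬a) a = ⊥-elim (¬a a)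

  ⌊⌋-true⁻ : (d : Dec A) → ⌊ d ⌋ ≡ true → A
  ⌊⌋-true⁻ (yes a) _ = a

lookup-ext : ∀ {A : Set} {n} {xs ys : Vec A n} → (∀ i → lookup xs i ≡ lookup ys i) → xs ≡ ys
lookup-ext {xs = xs} {ys} f =
  trans (sym (tabulate∘lookup xs)) (trans (tabulate-cong f) (tabulate∘lookup ys))

Subset-ext : ∀ {n} {S S′ : Subset n} → (∀ i → i ∈ S → i ∈ S′) → (∀ i → i ∈ S′ → i ∈ S) → S ≡ S′
Subset-ext {S = S} {S′} f g = lookup-ext λ i →
  ≡true-iff ([]=⇒lookup ∘ f i ∘ lookup⇒[]= i S) ([]=⇒lookup ∘ g i ∘ lookup⇒[]= i S′)

-- Walks

-- `PreGraph` records no laws; these hold for X and for its covers alike. Decidable equality of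
-- vertices serves loop erasure.
record Lawful (G : PreGraph) : Set where
  open PreGraph G
  field
    bar-invol : ∀ e → bar (bar e) ≡ e
    o-bar     : ∀ e → o (bar e) ≡ t e
    _≟ᵥ_      : DecidableEquality Vtx

  t-bar : ∀ e → t (bar e) ≡ o e
  t-bar e = trans (sym (o-bar (bar e))) (cong o (bar-invol e))

module Walks (G : PreGraph) (L : Lawful G) where
  open PreGraph G
  open Lawful L

  Walk : (Edge G → Set) → Vtx → Vtx → Set
  Walk P u v = ∃ λ es → Chain G u es v × All P es

  chain-++ : ∀ {u v w} es {fs} → Chain G u es v → Chain G v fs w → Chain G u (es ++ fs) w
  chain-++ []       refl     d = d
  chain-++ (e ∷ es) (oe , c) d = oe , chain-++ es c d

  walk-refl : ∀ {P u} → Walk P u u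
  walk-refl = [] , refl , []

  walk-edge : ∀ {P} e → P e → Walk P (o e) (t e)
  walk-edge e p = e ∷ [] , (refl , refl) , p ∷ []

  walk-trans : ∀ {P u v w} → Walk P u v → Walk P v w → Walk P u w
  walk-trans (es , c , ps) (fs , d , qs) = es ++ fs , chain-++ es c d , All.++⁺ ps qs

  walk-map : ∀ {P Q u v} → (∀ {e} → P e → Q e) → Walk P u v → Walk Q u v
  walk-map f (es , c , ps) = es , c , All.map f ps

  rev : List (Edge G) → List (Edge G)
  rev []       = []
  rev (e ∷ es) = rev es ++ bar e ∷ []

  chain-rev : ∀ {u v} es → Chain G u es v → Chain G v (rev es) u
  chain-rev []       refl       = refl
  chain-rev (e ∷ es) (refl , c) = chain-++ (rev es) (chain-rev es c) (o-bar e , t-bar e)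

  all-rev : ∀ {P : Edge G → Set} → (∀ e → P e → P (bar e)) → ∀ {es} → All P es → All P (rev es)
  all-rev cl []       = []
  all-rev cl (p ∷ ps) = All.++⁺ (all-rev cl ps) (cl _ p ∷ [])

  walk-sym : ∀ {P u v} → (∀ e → P e → P (bar e)) → Walk P u v → Walk P v u
  walk-sym cl (es , c , ps) = rev es , chain-rev es c , all-rev cl ps

  Path : (Edge G → Set) → Vtx → Vtx → Set
  Path P u v = Σ (List (Edge G)) λ es → Chain G u es v × All P es × Unique (verts G u es)

  path-suffix : ∀ {P u v w} es → Chain G u es v → All P es → Unique (verts G u es)
              → w LMem.∈ verts G u es → Path P w v
  path-suffix es       c       ps       uq       (here refl) = es , c , ps , uq
  path-suffix (e ∷ es) (_ , c) (_ ∷ ps) (_ ∷ uq) (there w∈) = path-suffix es c ps uq w∈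

  loop-erase : ∀ {P u v} es → Chain G u es v → All P es → Path P u v
  loop-erase []       c          []       = [] , c , [] , [] ∷ []
  loop-erase (e ∷ es) (refl , c) (p ∷ ps) with loop-erase es c ps
  ... | fs , d , qs , uq with DecMem._∈?_ _≟ᵥ_ (o e) (verts G (t e) fs)
  ...   | yes w∈ = path-suffix fs d qs uq w∈
  ...   | no  w∉ = e ∷ fs , (refl , d) , p ∷ qs , All.¬Any⇒All¬ _ w∉ ∷ uq

  -- A later edge equal to `e` or `bar e` would end at `t e` or `o e`, and both vertices have
  -- already been visited.
  path-distinct : ∀ {u v} es → Chain G u es v → Unique (verts G u es) → UndirDistinct G es
  path-distinct []       c          uq        = []
  path-distinct (e ∷ es) (refl , c) (u∉ ∷ uq) =
    All.tabulate (λ f∈ → (λ e≡f → All.lookup (AllPairs.head uq) (LMem.∈-map⁺ t f∈) (cong t e≡f)) ,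
                         (λ e≡f̄ → All.lookup (All.tail u∉) (LMem.∈-map⁺ t f∈)
                                     (trans (cong o e≡f̄) (o-bar _))))
    ∷ path-distinct es c uq

  -- After loop erasure each half has distinct undirected edges, and `disj` keeps the halves apart.
  -- Vertices common to both halves do no harm, since `HasCycleIn` only asks for distinct edges.
  two-walks⇒cycle : ∀ {P Q u v} (S : Subset nE) → (∀ {e} → P e → e ∈ S) → (∀ {e} → Q e → e ∈ S)
                  → (∀ {e f} → P e → Q f → e ≢ f × e ≢ bar f)
                  → u ≢ v → Walk P u v → Walk Q v u → HasCycleIn G S
  two-walks⇒cycle S P⊆S Q⊆S disj u≢v (es , c , ps) (fs , d , qs)
    with loop-erase es c ps | loop-erase fs d qs
  ... | [] , c′ , _ | _ = ⊥-elim (u≢v c′)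
  ... | e ∷ es′ , c′ , ps′ , uq | fs′ , d′ , qs′ , uq′ =
    _ , e , es′ ++ fs′ , chain-++ (e ∷ es′) c′ d′ ,
    All.++⁺ (All.map P⊆S ps′) (All.map Q⊆S qs′) ,
    AllPairs.++⁺ (path-distinct _ c′ uq) (path-distinct _ d′ uq′)
      (All.map (λ p → All.map (disj p) qs′) ps′)

-- Images of walks under vertex maps that keep (R) or contract (D) every edge

module Image (G H : PreGraph) (f : PreGraph.Vtx G → PreGraph.Vtx H)
             (R : Edge G → Edge H → Set) (D : Edge G → Set) where
  private
    module G = PreGraph G
    module H = PreGraph H

  Kept : (Edge H → Set) → Edge G → Set
  Kept Q x = Σ (Edge H) λ y → R x y × Q y × H.o y ≡ f (G.o x) × H.t y ≡ f (G.t x)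

  Contracted : Edge G → Set
  Contracted x = D x × f (G.o x) ≡ f (G.t x)

  Step : (Edge H → Set) → Edge G → Set
  Step Q x = Kept Q x ⊎ Contracted x

  image : ∀ {Q es} → All (Step Q) es → List (Edge H)
  image []                  = []
  image (inj₁ (y , _) ∷ ss) = y ∷ image ss
  image (inj₂ _ ∷ ss)       = image ss

  image-chain : ∀ {Q es u v} (ss : All (Step Q) es) → Chain G u es v → Chain H (f u) (image ss) (f v)
  image-chain []                                refl       = refl
  image-chain (inj₁ (y , r , q , oy , ty) ∷ ss) (refl , c) =
    oy , subst (λ w → Chain H w (image ss) _) (sym ty) (image-chain ss c)
  image-chain {v = v} (inj₂ (_ , eq) ∷ ss)      (refl , c) =
    subst (λ w → Chain H w (image ss) (f v)) (sym eq) (image-chain ss c)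

  image-all : ∀ {Q es} (ss : All (Step Q) es) → All Q (image ss)
  image-all []                          = []
  image-all (inj₁ (y , r , q , _) ∷ ss) = q ∷ image-all ss
  image-all (inj₂ _ ∷ ss)               = image-all ss

  module _ (L-G : Lawful G) (L-H : Lawful H) where
    image-walk : ∀ {P Q u v} → (∀ {x} → P x → Step Q x)
               → Walks.Walk G L-G P u v → Walks.Walk H L-H Q (f u) (f v)
    image-walk st (es , c , ps) = let ss = All.map st ps in image ss , image-chain ss c , image-all ss

  Injectiveᴿ : Set
  Injectiveᴿ = ∀ {x x′ y y′} → R x y → R x′ y′ →
               (y ≡ y′ → x ≡ x′) × (y ≡ H.bar y′ → x ≡ G.bar x′)

  image-distinct : ∀ {Q es} → Injectiveᴿ → (ss : All (Step Q) es) → UndirDistinct G es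
                 → UndirDistinct H (image ss)
  image-distinct inj [] [] = []
  image-distinct {Q} inj (inj₁ (y , r , _) ∷ ss) (d ∷ ds) = go ss d ∷ image-distinct inj ss ds
    where
    go : ∀ {es} (ss : All (Step Q) es) → All (λ x → _ ≢ x × _ ≢ G.bar x) es
       → All (λ y′ → y ≢ y′ × y ≢ H.bar y′) (image ss)
    go [] [] = []
    go (inj₁ (y′ , r′ , _) ∷ ss) ((ne , ne̅) ∷ ds) =
      (ne ∘ proj₁ (inj r r′) , ne̅ ∘ proj₂ (inj r r′)) ∷ go ss ds
    go (inj₂ _ ∷ ss) (_ ∷ ds) = go ss ds
  image-distinct inj (inj₂ _ ∷ ss) (d ∷ ds) = image-distinct inj ss ds

  -- The image of a closed trail is again a closed trail, hence a cycle as soon as one edge is kept.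
  -- When `D` is empty the second alternative is impossible.
  image-cycle : ∀ {u es} (S : Subset H.nE) → Injectiveᴿ → (ss : All (Step (_∈ S)) es)
              → Chain G u es u → UndirDistinct G es
              → HasCycleIn H S ⊎ All Contracted es
  image-cycle {u} S inj ss c d with image ss in eq | image-chain ss c | image-all ss | image-distinct inj ss d
  ... | y ∷ ys | c′ | a′ | d′ = inj₁ (f u , y , ys , c′ , a′ , d′)
  ... | [] | _ | _ | _ = inj₂ (go ss eq)
    where
    go : ∀ {es} (ss : All (Step (_∈ S)) es) → image ss ≡ [] → All Contracted es
    go []             _  = []
    go (inj₂ p ∷ ss) eq = p ∷ go ss eq
    go (inj₁ _ ∷ ss) ()

-- Admissible and closed paths

AllPairs-++⁻ : ∀ {A : Set} {R : A → A → Set} xs {ys} → AllPairs R (xs ++ ys) → AllPairs R xs × AllPairs R ys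
AllPairs-++⁻ []       rs       = [] , rs
AllPairs-++⁻ (x ∷ xs) (r ∷ rs) =
  let rxs , rys = AllPairs-++⁻ xs rs in All.++⁻ˡ xs r ∷ rxs , rys

lawful : ∀ {V E} {X : FinGraph V E} → IsGraph X → Lawful (toPre X)
lawful isG = record { bar-invol = bar-invol ; o-bar = o-bar ; _≟ᵥ_ = _≟_ }
  where open IsGraph isG

module Ears {V E : ℕ} (X : FinGraph V E) (isG : IsGraph X)
            (ram : Fin V → Set) (ram? : ∀ v → Dec (ram v)) where

  G : PreGraph
  G = toPre X

  open FinGraph X
  open Lawful (lawful isG)
  open Walks G (lawful isG)
  open Segments G ram

  -- The common shape of admissible paths (distinct ends) and of the closed
  -- paths defining 1-segments (equal ends).
  record Ear (a : Fin V) (es : List (Fin E)) (b : Fin V) : Set where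
    field
      chain    : Chain G a es b
      ram-a    : ram a
      ram-b    : ram b
      nonempty : es ≢ []
      uniq     : Unique (interior G es)
      unram    : All (λ w → ¬ ram w) (interior G es)

  interior-++ : ∀ {u w} e es f fs → Chain G u (e ∷ es) w →
                interior G ((e ∷ es) ++ f ∷ fs) ≡ interior G (e ∷ es) ++ w ∷ interior G (f ∷ fs)
  interior-++ e []        f fs (_ , refl) = refl
  interior-++ e (e′ ∷ es) f fs (_ , c)    = cong (t e ∷_) (interior-++ e′ es f fs c)

  map-t : ∀ {u v} e es → Chain G u (e ∷ es) v → map t (e ∷ es) ≡ interior G (e ∷ es) ++ v ∷ []
  map-t e []        (_ , refl) = refl
  map-t e (e′ ∷ es) (_ , c)    = cong (t e ∷_) (map-t e′ es c)

  record Split (Z : Fin V → Set) (a : Fin V) (es : List (Fin E)) (b : Fin V) : Set where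
    field
      u             : Fin V
      e₁ e₂         : Fin E
      es₁ es₂       : List (Fin E)
      eq            : es ≡ (e₁ ∷ es₁) ++ e₂ ∷ es₂
      chain₁        : Chain G a (e₁ ∷ es₁) u
      chain₂        : Chain G u (e₂ ∷ es₂) b
      hit           : Z u
      first         : All (λ w → ¬ Z w) (interior G (e₁ ∷ es₁))

    interior-eq : interior G es ≡ interior G (e₁ ∷ es₁) ++ u ∷ interior G (e₂ ∷ es₂)
    interior-eq = trans (cong (interior G) eq) (interior-++ e₁ es₁ e₂ es₂ chain₁)

  first-hit : ∀ {Z a b} → (∀ w → Dec (Z w)) → ∀ es → Chain G a es b →
              Any Z (interior G es) → Split Z a es b
  first-hit Z? (e ∷ f ∷ fs) (oe , c) z with Z? (t e)
  ... | yes zt = record { eq = refl ; chain₁ = oe , refl ; chain₂ = c ; hit = zt ; first = [] }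
  first-hit Z? (e ∷ f ∷ fs) (oe , c) (here z)  | no ¬zt = ⊥-elim (¬zt z)
  first-hit Z? (e ∷ f ∷ fs) (oe , c) (there z) | no ¬zt =
    record { eq = cong (e ∷_) S.eq ; chain₁ = oe , S.chain₁ ; chain₂ = S.chain₂
           ; hit = S.hit ; first = ¬zt ∷ S.first }
    where module S = Split (first-hit Z? (f ∷ fs) c z)

  open DecMem (_≟_ {V}) using (_∈?_)

  share : ∀ {e es fs} → EdgeOn G e es → EdgeOn G e fs → ShareEdge G es fs
  share {e} {es} {fs} p q = Any.map (λ { (inj₁ refl) → q ; (inj₂ refl) → Any.map swap q }) p
    where
    swap : ∀ {g} → g ≡ e ⊎ g ≡ bar e → g ≡ bar e ⊎ g ≡ bar (bar e)
    swap (inj₁ refl) = inj₂ (sym (bar-invol e))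
    swap (inj₂ refl) = inj₁ refl

  EdgeOn-∈ : ∀ {e es} → e LMem.∈ es → EdgeOn G e es
  EdgeOn-∈ = Any.map (inj₁ ∘ sym)

  shared? : ∀ es fs → Dec (ShareEdge G es fs)
  shared? es fs = Any.any? (λ e → Any.any? (λ f → (f ≟ e) ⊎-dec (f ≟ bar e)) fs) es

  distinct-++ : ∀ es {fs} → UndirDistinct G es → UndirDistinct G fs → ¬ ShareEdge G es fs →
                UndirDistinct G (es ++ fs)
  distinct-++ es d d′ ¬s = AllPairs.++⁺ d d′ (All.tabulate λ e∈ → All.tabulate λ f∈ →
    (λ { refl → ¬s (share (EdgeOn-∈ e∈) (EdgeOn-∈ f∈)) }) ,
    (λ { refl → ¬s (share (EdgeOn-∈ e∈) (Any.map (λ { refl → inj₂ (sym (bar-invol _)) }) f∈)) }))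

  -- `share₁` and `share₂` let the spliced path `Q` link the classes of `es` and `es′`. If both have
  -- distinct edges, a repeated edge of `Q` is common to them, hence the alternative in `dist`.
  -- `mid` and `within` serve to compare the interior of `Q` with the 2-segments.
  record Surgery (a : Fin V) (es es′ : List (Fin E)) (b′ : Fin V) : Set where
    field
      Q        : List (Fin E)
      ear      : Ear a Q b′
      share₁   : ShareEdge G es Q
      share₂   : ShareEdge G Q es′
      dist     : UndirDistinct G es → UndirDistinct G es′ → UndirDistinct G Q ⊎ ShareEdge G es es′
      mid      : ∃ λ u → u LMem.∈ interior G Q × u LMem.∈ interior G es′
      within   : ∀ {x} → x LMem.∈ interior G Q → x LMem.∈ interior G es ⊎ x LMem.∈ interior G es′

  -- Follow P up to its first interior vertex lying inside P′, then continue along P′.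
  surgery : ∀ {a es b a′ es′ b′ w} → Ear a es b → Ear a′ es′ b′ →
            w LMem.∈ interior G es → w LMem.∈ interior G es′ → Surgery a es es′ b′
  surgery {a} {es} {b} {a′} {es′} {b′} P P′ w∈ w∈′ = record
    { Q = A ++ B′
    ; ear = record
      { chain = chain-++ A S.chain₁ c₂
      ; ram-a = P.ram-a ; ram-b = P′.ram-b ; nonempty = λ ()
      ; uniq = subst Unique (sym Q-int) (Unique.++⁺ (proj₁ uniq-es) (proj₂ uniq-es′)
                 λ (x∈ , x∈′) → All.lookup S.first x∈ (B′-sub x∈′))
      ; unram = subst (All _) (sym Q-int)
          (All.++⁺ (All.++⁻ˡ (interior G A) (subst (All _) S.interior-eq P.unram))
                   (All.++⁻ʳ (interior G A′) (subst (All _) int′ P′.unram)))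
      }
    ; share₁ = subst (λ l → ShareEdge G l (A ++ B′)) (sym S.eq) (here (here (inj₁ refl)))
    ; share₂ = subst (ShareEdge G (A ++ B′)) (sym S′.eq)
                 (Any.++⁺ʳ A (here (Any.++⁺ʳ A′ (here (inj₁ refl)))))
    ; dist = dist
    ; mid = S.u , subst (S.u LMem.∈_) (sym Q-int) (LMem.∈-++⁺ʳ _ (here refl)) , S.hit
    ; within = λ x∈ → [ (λ p → inj₁ (subst (_ LMem.∈_) (sym S.interior-eq) (LMem.∈-++⁺ˡ p)))
                      , inj₂ ∘ B′-sub ]′ (LMem.∈-++⁻ _ (subst (_ LMem.∈_) Q-int x∈))
    }
    where
    module P = Ear P
    module P′ = Ear P′
    module S = Split (first-hit (_∈? interior G es′) es P.chain (LMem.lose w∈ w∈′))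
    -- `es′` is cut at the same vertex `S.u`. No earlier interior vertex of `es` lies inside `es′`,
    -- so the prefix of the one and the suffix of the other have no interior vertex in common.
    module S′ = Split (first-hit (_≟ S.u) es′ P′.chain (Any.map sym S.hit))
    A = S.e₁ ∷ S.es₁
    A′ = S′.e₁ ∷ S′.es₁
    B′ = S′.e₂ ∷ S′.es₂
    c₂ : Chain G S.u B′ b′
    c₂ = subst (λ x → Chain G x B′ b′) S′.hit S′.chain₂
    Q-int : interior G (A ++ B′) ≡ interior G A ++ S.u ∷ interior G B′
    Q-int = interior-++ S.e₁ S.es₁ S′.e₂ S′.es₂ S.chain₁
    int′ : interior G es′ ≡ interior G A′ ++ S.u ∷ interior G B′
    int′ = trans S′.interior-eq (cong (λ x → interior G A′ ++ x ∷ interior G B′) S′.hit)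
    uniq-es = AllPairs-++⁻ (interior G A) (subst Unique S.interior-eq P.uniq)
    uniq-es′ = AllPairs-++⁻ (interior G A′) (subst Unique int′ P′.uniq)
    B′-sub : ∀ {x} → x LMem.∈ S.u ∷ interior G B′ → x LMem.∈ interior G es′
    B′-sub x∈ = subst (_ LMem.∈_) (sym int′) (LMem.∈-++⁺ʳ (interior G A′) x∈)
    dist : UndirDistinct G es → UndirDistinct G es′ → UndirDistinct G (A ++ B′) ⊎ ShareEdge G es es′
    dist d d′ with shared? A B′
    ... | yes s = inj₂ (subst₂ (ShareEdge G) (sym S.eq) (sym S′.eq)
                    (Any.++⁺ˡ (Any.map (Any.++⁺ʳ A′) s)))
    ... | no ¬s = inj₁ (distinct-++ A (proj₁ (AllPairs-++⁻ A (subst (UndirDistinct G) S.eq d)))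
                    (proj₂ (AllPairs-++⁻ A′ (subst (UndirDistinct G) S′.eq d′))) ¬s)

  interior-snoc : ∀ xs x y → interior G ((xs ++ x ∷ []) ++ y ∷ []) ≡ interior G (xs ++ x ∷ []) ++ t x ∷ []
  interior-snoc []           x y = refl
  interior-snoc (z ∷ [])     x y = refl
  interior-snoc (z ∷ z′ ∷ xs) x y = cong (t z ∷_) (interior-snoc (z′ ∷ xs) x y)

  interior-rev : ∀ {u v} e f es → Chain G u (e ∷ f ∷ es) v →
                 interior G (rev (e ∷ f ∷ es)) ≡ interior G (rev (f ∷ es)) ++ t e ∷ []
  interior-rev e f es (_ , of , _) = trans (interior-snoc (rev es) (bar f) (bar e))
    (cong (λ x → interior G (rev (f ∷ es)) ++ x ∷ []) (trans (t-bar f) of))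

  interior-rev⊆ : ∀ {u v x} es → Chain G u es v → x LMem.∈ interior G (rev es) → x LMem.∈ interior G es
  interior-rev⊆ []           c ()
  interior-rev⊆ (e ∷ [])     c ()
  interior-rev⊆ (e ∷ f ∷ es) c x∈ =
    [ there ∘ interior-rev⊆ (f ∷ es) (proj₂ c) , (λ { (here eq) → here eq }) ]′
    (LMem.∈-++⁻ (interior G (rev (f ∷ es))) (subst (_ LMem.∈_) (interior-rev e f es c) x∈))

  interior-rev⊇ : ∀ {u v x} es → Chain G u es v → x LMem.∈ interior G es → x LMem.∈ interior G (rev es)
  interior-rev⊇ (e ∷ f ∷ es) c x∈ = subst (_ LMem.∈_) (sym (interior-rev e f es c)) (go x∈)
    where
    go : ∀ {x} → x LMem.∈ t e ∷ interior G (f ∷ es) → x LMem.∈ interior G (rev (f ∷ es)) ++ t e ∷ []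
    go (here refl) = LMem.∈-++⁺ʳ _ (here refl)
    go (there p)   = LMem.∈-++⁺ˡ (interior-rev⊇ (f ∷ es) (proj₂ c) p)

  unique-rev : ∀ {u v} es → Chain G u es v → Unique (interior G es) → Unique (interior G (rev es))
  unique-rev []           c uq       = []
  unique-rev (e ∷ [])     c uq       = []
  unique-rev (e ∷ f ∷ es) c (n ∷ uq) = subst Unique (sym (interior-rev e f es c))
    (Unique.++⁺ (unique-rev (f ∷ es) (proj₂ c) uq) ([] ∷ [])
      λ { (x∈ , here refl) → All.lookup n (interior-rev⊆ (f ∷ es) (proj₂ c) x∈) refl })

  ear-rev : ∀ {a es b} → Ear a es b → Ear b (rev es) a
  ear-rev {es = es} P = record
    { chain = chain-rev es chain ; ram-a = ram-b ; ram-b = ram-a ; nonempty = ne es nonempty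
    ; uniq = unique-rev es chain uniq
    ; unram = All.tabulate (λ x∈ → All.lookup unram (interior-rev⊆ es chain x∈)) }
    where
    open Ear P
    ne : ∀ es → es ≢ [] → rev es ≢ []
    ne []       n _  = n refl
    ne (e ∷ es) n eq with rev es | eq
    ... | []    | ()
    ... | _ ∷ _ | ()

  EdgeOn-rev : ∀ {e} es → EdgeOn G e (rev es) → EdgeOn G e es
  EdgeOn-rev {e} (f ∷ es) p with Any.++⁻ (rev es) p
  ... | inj₁ q                  = there (EdgeOn-rev es q)
  ... | inj₂ (here (inj₁ refl)) = here (inj₂ (sym (bar-invol f)))
  ... | inj₂ (here (inj₂ eq))   = here (inj₁ (trans (sym (bar-invol f)) (trans (cong bar eq) (bar-invol e))))

  ear-vert : ∀ {a es b w} → Ear a es b → VertOn G w es → w ≡ a ⊎ w ≡ b ⊎ w LMem.∈ interior G es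
  ear-vert P = go _ (Ear.chain P)
    where
    go : ∀ {a b w} es → Chain G a es b → VertOn G w es → w ≡ a ⊎ w ≡ b ⊎ w LMem.∈ interior G es
    go (e ∷ [])     (refl , refl) (here (inj₁ refl)) = inj₁ refl
    go (e ∷ [])     (refl , refl) (here (inj₂ refl)) = inj₂ (inj₁ refl)
    go (e ∷ f ∷ es) (refl , c)    (here (inj₁ refl)) = inj₁ refl
    go (e ∷ f ∷ es) (refl , c)    (here (inj₂ refl)) = inj₂ (inj₂ (here refl))
    go (e ∷ f ∷ es) (refl , c)    (there p) with go (f ∷ es) c p
    ... | inj₁ refl        = inj₂ (inj₂ (here refl))
    ... | inj₂ (inj₁ refl) = inj₂ (inj₁ refl)
    ... | inj₂ (inj₂ w∈)   = inj₂ (inj₂ (there w∈))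

  ear-unram-vert : ∀ {a es b w} → Ear a es b → ¬ ram w → VertOn G w es → w LMem.∈ interior G es
  ear-unram-vert P ¬r p with ear-vert P p
  ... | inj₁ refl        = ⊥-elim (¬r (Ear.ram-a P))
  ... | inj₂ (inj₁ refl) = ⊥-elim (¬r (Ear.ram-b P))
  ... | inj₂ (inj₂ w∈)   = w∈

  ear-ram-vert : ∀ {a es b w} → Ear a es b → ram w → VertOn G w es → w ≡ a ⊎ w ≡ b
  ear-ram-vert P r p with ear-vert P p
  ... | inj₁ eq        = inj₁ eq
  ... | inj₂ (inj₁ eq) = inj₂ eq
  ... | inj₂ (inj₂ w∈) = ⊥-elim (All.lookup (Ear.unram P) w∈ r)

  EdgeOn⇒o : ∀ {e es} → EdgeOn G e es → VertOn G (o e) es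
  EdgeOn⇒o = Any.map λ { (inj₁ refl) → inj₁ refl ; (inj₂ refl) → inj₂ (t-bar _) }

  EdgeOn⇒t : ∀ {e es} → EdgeOn G e es → VertOn G (t e) es
  EdgeOn⇒t = Any.map λ { (inj₁ refl) → inj₂ refl ; (inj₂ refl) → inj₁ (o-bar _) }

  VertOn⇒EdgeOn : ∀ {w es} → VertOn G w es → ∃ λ e → o e ≡ w × EdgeOn G e es
  VertOn⇒EdgeOn p with LMem.find p
  ... | e , e∈ , inj₁ oe = e , oe , EdgeOn-∈ e∈
  ... | e , e∈ , inj₂ te = bar e , trans (o-bar e) te , Any.map (λ { refl → inj₂ (sym (bar-invol e)) }) e∈

  interior⇒VertOn : ∀ {w} es → w LMem.∈ interior G es → VertOn G w es
  interior⇒VertOn (e ∷ f ∷ es) (here refl) = here (inj₂ refl)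
  interior⇒VertOn (e ∷ f ∷ es) (there p)   = there (interior⇒VertOn (f ∷ es) p)

  adm-ear : ∀ {a b es} → Adm a b es → Ear a es b
  adm-ear {es = []} ((c , _) , a≢b , _) = ⊥-elim (a≢b c)
  adm-ear {es = e ∷ es} ((c , _ ∷ uq) , a≢b , ra , rb , ur) = record
    { chain = c ; ram-a = ra ; ram-b = rb ; nonempty = λ () ; unram = ur
    ; uniq = proj₁ (AllPairs-++⁻ (interior G (e ∷ es)) (subst Unique (map-t e es c) uq)) }

  ear-adm : ∀ {a b es} → Ear a es b → a ≢ b → Adm a b es
  ear-adm {es = []}     P a≢b = ⊥-elim (Ear.nonempty P refl)
  ear-adm {a} {b} {e ∷ es} P a≢b = (chain , uq) , a≢b , ram-a , ram-b , unram
    where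
    open Ear P
    uq : Unique (a ∷ map t (e ∷ es))
    uq = subst (λ l → Unique (a ∷ l)) (sym (map-t e es chain))
      (All.++⁺ (All.map (λ ¬r → λ { refl → ¬r ram-a }) unram) (a≢b ∷ [])
      ∷ Unique.++⁺ uniq ([] ∷ []) λ { (x∈ , here refl) → All.lookup unram x∈ ram-b })

  closed-ear : ∀ {v es} → ClosedAt v es → Ear v es v
  closed-ear (rv , (e , fs , refl) , c , _ , uq , al) = record
    { chain = c ; ram-a = rv ; ram-b = rv ; nonempty = λ () ; uniq = uq ; unram = All.map proj₁ al }

  closed-no2 : ∀ {v es w} → ClosedAt v es → w LMem.∈ interior G es → ¬ VertIn2Seg w
  closed-no2 (_ , _ , _ , _ , _ , al) w∈ = proj₂ (All.lookup al w∈)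

  ear-closed : ∀ {v es} → Ear v es v → UndirDistinct G es →
               (∀ {w} → w LMem.∈ interior G es → ¬ VertIn2Seg w) → ClosedAt v es
  ear-closed {es = []}     P d n = ⊥-elim (Ear.nonempty P refl)
  ear-closed {es = e ∷ es} P d n = ram-a , (e , es , refl) , chain , d , uniq ,
    All.tabulate (λ w∈ → All.lookup unram w∈ , n w∈)
    where open Ear P

  path-no-loop : ∀ {a b e} es → Chain G a es b → Unique (verts G a es) → e LMem.∈ es → o e ≢ t e
  path-no-loop (e ∷ es) (refl , c) ((n ∷ _) ∷ uq) (here refl) = n
  path-no-loop (e ∷ es) (_ , c)    (_ ∷ uq)       (there e∈)  = path-no-loop es c uq e∈

  -- Both ends of a shared edge lie in a 2-segment, so neither is interior to the closed path and
  -- both equal `v`. The edge would be a loop, which a path does not contain.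
  adm-closed-disjoint : ∀ {a b v P Q} → Adm a b P → ClosedAt v Q → ¬ ShareEdge G P Q
  adm-closed-disjoint {a} {b} {v} {P} {Q} A C s with LMem.find s
  ... | e , e∈ , e∈Q = path-no-loop P (proj₁ (proj₁ A)) (proj₂ (proj₁ A)) e∈
                         (trans (end (inj₁ refl) (EdgeOn⇒o e∈Q)) (sym (end (inj₂ refl) (EdgeOn⇒t e∈Q))))
    where
    end : ∀ {w} → o e ≡ w ⊎ t e ≡ w → VertOn G w Q → w ≡ v
    end {w} at p with ear-vert (closed-ear C) p
    ... | inj₁ eq        = eq
    ... | inj₂ (inj₁ eq) = eq
    ... | inj₂ (inj₂ w∈) = ⊥-elim (closed-no2 C w∈ (a , b , P , A , Any.map (λ { refl → at }) e∈))

  -- Splicing would give an admissible path from `v` to `v′` through an interior vertex of `Q`,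
  -- contrary to the definition of a closed path.
  closed-apart : ∀ {v v′ P Q w} → ClosedAt v P → ClosedAt v′ Q → v ≢ v′ →
                 w LMem.∈ interior G P → ¬ (w LMem.∈ interior G Q)
  closed-apart {v} {v′} C C′ v≢v′ w∈ w∈′ =
    let u , u∈ , u∈′ = S.mid in
    closed-no2 C′ u∈′ (v , v′ , S.Q , ear-adm S.ear v≢v′ , interior⇒VertOn S.Q u∈)
    where module S = Surgery (surgery (closed-ear C) (closed-ear C′) w∈ w∈′)

  closed-share : ∀ {v v′ P Q} → ClosedAt v P → ClosedAt v′ Q → ShareEdge G P Q → v ≡ v′
  closed-share {v} {v′} C C′ s with LMem.find s
  ... | e , e∈P , e∈Q with v ≟ v′ | ram? (o e)
  ...   | yes eq | _ = eq
  ...   | no v≢v′ | yes r = trans (sym (at C (EdgeOn⇒o (EdgeOn-∈ e∈P)))) (at C′ (EdgeOn⇒o e∈Q))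
    where
    at : ∀ {v P} → ClosedAt v P → VertOn G (o e) P → o e ≡ v
    at C p = [ id , id ]′ (ear-ram-vert (closed-ear C) r p)
  ...   | no v≢v′ | no ¬r = ⊥-elim (closed-apart C C′ v≢v′
    (ear-unram-vert (closed-ear C) ¬r (EdgeOn⇒o (EdgeOn-∈ e∈P)))
    (ear-unram-vert (closed-ear C′) ¬r (EdgeOn⇒o e∈Q)))

  data Kind (Q : List (Fin E)) : Set where
    adm    : ∀ {a b} → Adm a b Q → Kind Q
    closed : ∀ {v} → ClosedAt v Q → Kind Q

  class-kind : ∀ r {Q} → InClass r Q → Kind Q
  class-kind (seg2 v v′ P) (inj₁ A , _) = adm A
  class-kind (seg2 v v′ P) (inj₂ A , _) = adm A
  class-kind (seg1 v P)    (C , _)      = closed C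

  class-ear : ∀ r {Q} → InClass r Q → ∃ λ a → ∃ λ b → Ear a Q b × Marked r a × Marked r b
  class-ear (seg2 v v′ P) (inj₁ A , _) = v , v′ , adm-ear A , inj₁ refl , inj₂ refl
  class-ear (seg2 v v′ P) (inj₂ A , _) = v′ , v , adm-ear A , inj₂ refl , inj₁ refl
  class-ear (seg1 v P)    (C , _)      = v , v , closed-ear C , refl , refl

  kind-ear : ∀ {Q} → Kind Q → ∃ λ a → ∃ λ b → Ear a Q b
  kind-ear (adm A)    = _ , _ , adm-ear A
  kind-ear (closed C) = _ , _ , closed-ear C

  share-sym : ∀ {P Q} → ShareEdge G P Q → ShareEdge G Q P
  share-sym s with LMem.find s
  ... | e , e∈ , e∈Q = share e∈Q (EdgeOn-∈ e∈)

  -- Segments meet only in ramified vertices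

  module Classes (condA : CondA) where

    admPair-step : ∀ {v v′ P a b Q} → AdmPair v v′ P → Adm a b Q → ShareEdge G P Q → AdmPair v v′ Q
    admPair-step (inj₁ A) A′ s with condA _ _ _ _ _ _ A A′ s
    ... | inj₁ (refl , refl) = inj₁ A′
    ... | inj₂ (refl , refl) = inj₂ A′
    admPair-step (inj₂ A) A′ s with condA _ _ _ _ _ _ A A′ s
    ... | inj₁ (refl , refl) = inj₂ A′
    ... | inj₂ (refl , refl) = inj₁ A′

    class-step : ∀ r {P Q} → InClass r P → Kind Q → ShareEdge G P Q → InClass r Q
    class-step (seg2 v v′ _) (AP , lk) (adm A′) s =
      let AP′ = admPair-step AP A′ s in AP′ , lk ◅◅ (AP , AP′ , s) ◅ ε
    class-step (seg2 v v′ _) (inj₁ A , _) (closed C) s = ⊥-elim (adm-closed-disjoint A C s)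
    class-step (seg2 v v′ _) (inj₂ A , _) (closed C) s = ⊥-elim (adm-closed-disjoint A C s)
    class-step (seg1 v _)    (C , _) (adm A) s = ⊥-elim (adm-closed-disjoint A C (share-sym s))
    class-step (seg1 v _)    (C , lk) (closed C′) s with closed-share C C′ s
    ... | refl = C′ , lk ◅◅ (C , C′ , s) ◅ ε

    adm-meet : ∀ {a b P a′ b′ Q w} → Adm a b P → Adm a′ b′ Q →
               w LMem.∈ interior G P → w LMem.∈ interior G Q →
               ∃ λ R → Kind R × ShareEdge G P R × ShareEdge G R Q
    adm-meet {a} {Q = Q} A A′ w∈ w∈′ with a ≟ _
    ... | no a≢b′ = S.Q , adm (ear-adm S.ear a≢b′) , S.share₁ , S.share₂
      where module S = Surgery (surgery (adm-ear A) (adm-ear A′) w∈ w∈′)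
    -- The splice would return to `a`, so `Q` is followed backwards instead: its start differs from
    -- its end, which is `a`.
    ... | yes refl = S.Q , adm (ear-adm S.ear (proj₁ (proj₂ A′) ∘ sym)) , S.share₁ ,
                     Any.map (EdgeOn-rev Q) S.share₂
      where module S = Surgery (surgery (adm-ear A) (ear-rev (adm-ear A′)) w∈
                                  (interior-rev⊇ Q (proj₁ (proj₁ A′)) w∈′))

    -- Two admissible paths, or two closed paths at one vertex, are spliced at `w` into a third that
    -- shares an edge with each. The splice of closed paths can repeat an edge only if the two
    -- already share one. The mixed case cannot occur, because the interior of a closed path avoids
    -- all 2-segments.
    class-meet : ∀ r {P Q w} → InClass r P → Kind Q → ¬ ram w → VertOn G w P → VertOn G w Q → InClass r Q
    class-meet r {P} {Q} inP K′ ¬r p q = go (class-kind r inP) K′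
      where
      w∈ = ear-unram-vert (proj₂ (proj₂ (kind-ear (class-kind r inP)))) ¬r p
      w∈′ = ear-unram-vert (proj₂ (proj₂ (kind-ear K′))) ¬r q
      go : Kind P → Kind Q → InClass r Q
      go (adm A) (adm A′) with adm-meet A A′ w∈ w∈′
      ... | R , K , s , s′ = class-step r (class-step r inP K s) K′ s′
      go (adm A) (closed C) = ⊥-elim (closed-no2 C w∈′ (_ , _ , P , A , p))
      go (closed C) (adm A) = ⊥-elim (closed-no2 C w∈ (_ , _ , Q , A , q))
      go (closed {v} C) (closed {v′} C′) with v ≟ v′
      ... | no v≢v′ = ⊥-elim (closed-apart C C′ v≢v′ w∈ w∈′)
      ... | yes refl with S.dist (dist C) (dist C′)
        where
        module S = Surgery (surgery (closed-ear C) (closed-ear C′) w∈ w∈′)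
        dist : ∀ {v P} → ClosedAt v P → UndirDistinct G P
        dist (_ , _ , _ , d , _) = d
      ...   | inj₂ s = class-step r inP K′ s
      ...   | inj₁ d = class-step r (class-step r inP (closed CQ) S.share₁) K′ S.share₂
        where
        module S = Surgery (surgery (closed-ear C) (closed-ear C′) w∈ w∈′)
        CQ : ClosedAt v S.Q
        CQ = ear-closed S.ear d λ x∈ → [ closed-no2 C , closed-no2 C′ ]′ (S.within x∈)

  -- A 1-segment gets two equal ends, so that both kinds of segment are treated alike, with a pair
  -- of marks.
  end₁ end₂ : SegRep → Fin V
  end₁ (seg2 v v′ _) = v
  end₁ (seg1 v _)    = v
  end₂ (seg2 v v′ _) = v′
  end₂ (seg1 v _)    = v

  marked⇒end : ∀ r {w} → Marked r w → w ≡ end₁ r ⊎ w ≡ end₂ r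
  marked⇒end (seg2 _ _ _) m = m
  marked⇒end (seg1 _ _)   m = inj₁ m

  end⇒marked : ∀ r {w} → w ≡ end₁ r ⊎ w ≡ end₂ r → Marked r w
  end⇒marked (seg2 _ _ _) m = m
  end⇒marked (seg1 _ _)   m = [ id , id ]′ m

  ram-ends : ∀ r → ValidRep r → ram (end₁ r) × ram (end₂ r)
  ram-ends (seg2 _ _ _) (_ , _ , ra , rb , _) = ra , rb
  ram-ends (seg1 _ _)   (rv , _)              = rv , rv

  -- The labelling of edges by segments

  module Decomp (D : SegDecomp) (edge2? : ∀ e → Dec (EdgeIn2Seg e)) where
    open SegDecomp D
    open Classes condA

    -- Condition (b) provides closed paths only for edges outside every 2-segment, hence the
    -- decision `edge2?`. The label of `e` is the class of this one path; `segOf-unique` shows that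
    -- the choice is immaterial.
    edge-path : ∀ e → ∃ λ Q → EdgeOn G e Q × Kind Q × ∃ λ i → InClass (seg i) Q
    edge-path e with edge2? e
    ... | yes (a , b , Q , A , e∈) = Q , e∈ , adm A , cover2 a b Q A
    ... | no ¬2 with condB e ¬2
    ...   | v , Q , C , e∈ = Q , e∈ , closed C , cover1 v Q C

    segOf : Fin E → Fin k
    segOf e = proj₁ (proj₂ (proj₂ (proj₂ (edge-path e))))

    segOf-sound : ∀ e → SegEdge (seg (segOf e)) e
    segOf-sound e with edge-path e
    ... | Q , e∈ , K , i , inQ = Q , inQ , e∈

    segOf-unique : ∀ {i e} → SegEdge (seg i) e → segOf e ≡ i
    segOf-unique {i} {e} (P , inP , e∈P) with edge-path e
    ... | Q , e∈ , K , j , inQ = distinct j i Q inQ (class-step (seg i) inP K (share e∈P e∈))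

    EdgeOn-bar : ∀ {e es} → EdgeOn G e es → EdgeOn G (bar e) es
    EdgeOn-bar {e} = Any.map λ { (inj₁ eq) → inj₂ (trans eq (sym (bar-invol e))) ; (inj₂ eq) → inj₁ eq }

    segOf-bar : ∀ e → segOf (bar e) ≡ segOf e
    segOf-bar e with segOf-sound e
    ... | Q , inQ , e∈ = segOf-unique (Q , inQ , EdgeOn-bar e∈)

    segOf-at : ∀ {e f} → o e ≡ o f → ¬ ram (o e) → segOf e ≡ segOf f
    segOf-at {e} {f} eq ¬r with segOf-sound e | edge-path f
    ... | P , inP , e∈P | Q , f∈ , K , j , inQ =
      distinct _ j Q (class-meet _ inP K ¬r (EdgeOn⇒o e∈P) (subst (λ w → VertOn G w Q) (sym eq) (EdgeOn⇒o f∈))) inQ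

    segOf-end : ∀ e → ram (o e) → o e ≡ end₁ (seg (segOf e)) ⊎ o e ≡ end₂ (seg (segOf e))
    segOf-end e r with segOf-sound e
    ... | Q , inQ , e∈ with class-ear (seg (segOf e)) inQ
    ...   | a , b , P , ma , mb = marked⇒end (seg (segOf e))
      ([ (λ { eq → subst (Marked _) (sym eq) ma }) , (λ { eq → subst (Marked _) (sym eq) mb }) ]′
       (ear-ram-vert P r (EdgeOn⇒o e∈)))

    segVert⇒edge : ∀ {i w} → SegVert (seg i) w → ∃ λ e → o e ≡ w × segOf e ≡ i
    segVert⇒edge (Q , inQ , w∈) with VertOn⇒EdgeOn w∈
    ... | e , oe , e∈ = e , oe , segOf-unique (Q , inQ , e∈)

    edge⇒segVert : ∀ {e} → SegVert (seg (segOf e)) (o e)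
    edge⇒segVert {e} with segOf-sound e
    ... | Q , inQ , e∈ = Q , inQ , EdgeOn⇒o e∈

    ram-exists : Fin E → ∃ ram
    ram-exists e with edge-path e
    ... | Q , _ , K , _ with kind-ear K
    ...   | a , _ , P = a , Ear.ram-a P

-- Covers of a segmented graph

-- All that the count needs of a decomposition: a labelling of the edges that changes only at
-- ramified vertices, and two marks for each label. `out` excludes isolated unramified vertices,
-- which would belong to no segment.
record Segmentation {V E : ℕ} (X : FinGraph V E) (ram : Fin V → Set) : Set where
  open FinGraph X
  field
    ram?    : ∀ v → Dec (ram v)
    k       : ℕ
    sg      : Fin E → Fin k
    sg-bar  : ∀ e → sg (bar e) ≡ sg e
    sg-at   : ∀ {e f} → o e ≡ o f → ¬ ram (o e) → sg e ≡ sg f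
    a b     : Fin k → Fin V
    ram-a   : ∀ i → ram (a i)
    ram-b   : ∀ i → ram (b i)
    sg-end  : ∀ e → ram (o e) → o e ≡ a (sg e) ⊎ o e ≡ b (sg e)
    out     : ∀ v → ¬ ram v → ∃ λ e → o e ≡ v

  Mark : Fin k → Fin V → Set
  Mark i w = w ≡ a i ⊎ w ≡ b i

  ram-mark : ∀ {i w} → Mark i w → ram w
  ram-mark (inj₁ refl) = ram-a _
  ram-mark (inj₂ refl) = ram-b _

  -- Every vertex of a segment is the origin of one of its edges, so `spans` can range over edges.
  -- When the two marks coincide, `separated` holds trivially and the forest is a tree.
  record Forest (i : Fin k) (F : Subset E) : Set where
    field
      inside    : ∀ {e} → e ∈ F → sg e ≡ i
      closed    : BarClosed (toPre X) F
      acyclic   : AcyclicIn (toPre X) F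
      spans     : ∀ e → sg e ≡ i → ∃ λ m → Mark i m × WalkIn (toPre X) F (o e) m
      separated : ∀ {m m′} → Mark i m → Mark i m′ → WalkIn (toPre X) F m m′ → m ≡ m′

  part : Subset E → Fin k → Subset E
  part S i = tabulate λ e → lookup S e ∧ ⌊ sg e ≟ i ⌋

  part⁺ : ∀ {S i e} → e ∈ S → sg e ≡ i → e ∈ part S i
  part⁺ {S} {i} {e} e∈ eq = ∈-tabulate⁺ (cong₂ _∧_ ([]=⇒lookup e∈) (⌊⌋-true⁺ (sg e ≟ i) eq))

  part⁻ : ∀ {S i e} → e ∈ part S i → e ∈ S × sg e ≡ i
  part⁻ {S} {i} {e} e∈ =
    let p , p′ = ∧-true⁻ (∈-tabulate⁻ e∈)
    in lookup⇒[]= _ S p , ⌊⌋-true⁻ (sg e ≟ i) p′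

  part-closed : ∀ {S} i → BarClosed (toPre X) S → BarClosed (toPre X) (part S i)
  part-closed i cl e e∈ = let e∈S , eq = part⁻ e∈ in part⁺ (cl e e∈S) (trans (sg-bar e) eq)

  -- The condition on the marks excludes 1-segments: their copies hang at a single vertex, so none
  -- is distinguished and every trace is a segmental forest.
  Joined : Fin k → Subset E → Set
  Joined i F = a i ≢ b i × WalkIn (toPre X) F (a i) (b i)

-- The fibres over V of a q-sheeted cover ramified totally over ram.
record Fibres (V : ℕ) (ram : Fin V → Set) (q : ℕ) : Set₁ where
  field
    Vtx     : Set
    pt      : Fin V → Fin q → Vtx
    base    : Vtx → Fin V
    sheet   : Vtx → Fin q
    pt-surj : ∀ y → pt (base y) (sheet y) ≡ y
    base-pt : ∀ v g → base (pt v g) ≡ v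
    sheet-pt : ∀ {v} g → ¬ ram v → sheet (pt v g) ≡ g
    pt-ram  : ∀ {v} g h → ram v → pt v g ≡ pt v h

module Cover {V E : ℕ} (X : FinGraph V E) (isG : IsGraph X) (ram : Fin V → Set)
             (Sg : Segmentation X ram) (q : ℕ) (g₀ : Fin q) (Fb : Fibres V ram q) where
  open FinGraph X
  open Segmentation Sg
  open Fibres Fb

  G : PreGraph
  G = toPre X

  LG : Lawful G
  LG = lawful isG

  module GL = Lawful LG
  module GW = Walks G LG

  eb : Fin (E * q) → Fin E
  eb x = proj₁ (remQuot {E} q x)

  sh : Fin (E * q) → Fin q
  sh x = proj₂ (remQuot {E} q x)

  -- For the fibres of a layer this unfolds to `Layer` itself, so the count for `Y` applies there
  -- without transport.
  Y : PreGraph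
  Y = record
    { Vtx = Vtx ; nE = E * q
    ; o = λ x → pt (o (eb x)) (sh x)
    ; t = λ x → pt (t (eb x)) (sh x)
    ; bar = λ x → combine (bar (eb x)) (sh x) }

  module Y = PreGraph Y

  combine-eb : ∀ x → combine (eb x) (sh x) ≡ x
  combine-eb x = combine-remQuot {E} q x

  eb-combine : ∀ e g → eb (combine e g) ≡ e
  eb-combine e g = cong proj₁ (remQuot-combine e g)

  sh-combine : ∀ e g → sh (combine e g) ≡ g
  sh-combine e g = cong proj₂ (remQuot-combine {E} e g)

  bar-combine : ∀ e g → Y.bar (combine e g) ≡ combine (bar e) g
  bar-combine e g = cong₂ (λ e g → combine (bar e) g) (eb-combine e g) (sh-combine e g)

  o-combine : ∀ e g → Y.o (combine e g) ≡ pt (o e) g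
  o-combine e g = cong₂ (λ e g → pt (o e) g) (eb-combine e g) (sh-combine e g)

  t-combine : ∀ e g → Y.t (combine e g) ≡ pt (t e) g
  t-combine e g = cong₂ (λ e g → pt (t e) g) (eb-combine e g) (sh-combine e g)

  combine-inj : ∀ {e g e′ g′} → combine {E} {q} e g ≡ combine e′ g′ → e ≡ e′ × g ≡ g′
  combine-inj = combine-injective _ _ _ _

  LY : Lawful Y
  LY = record
    { bar-invol = λ x → trans (bar-combine _ _)
        (trans (cong (λ e → combine e (sh x)) (GL.bar-invol (eb x))) (combine-eb x))
    ; o-bar = λ x → trans (o-combine _ _) (cong (λ v → pt v (sh x)) (GL.o-bar (eb x)))
    ; _≟ᵥ_ = λ y y′ → dec y y′ (base y ≟ base y′) (sheet y ≟ sheet y′) }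
    where
    dec : ∀ y y′ → Dec (base y ≡ base y′) → Dec (sheet y ≡ sheet y′) → Dec (y ≡ y′)
    dec y y′ (yes p) (yes p′) = yes (trans (sym (pt-surj y)) (trans (cong₂ pt p p′) (pt-surj y′)))
    dec y y′ (no ¬p) _        = no (¬p ∘ cong base)
    dec y y′ _       (no ¬p)  = no (¬p ∘ cong sheet)

  module YW = Walks Y LY

  -- The terminus of `e` is the origin of `bar e`, which has the same label; hence facts about ends
  -- of edges are proved for origins only.
  at-t : ∀ {Φ : Fin V → Fin k → Set} → (∀ e → Φ (o e) (sg e)) → ∀ e → Φ (t e) (sg e)
  at-t {Φ} f e = subst₂ Φ (GL.o-bar e) (sg-bar e) (f (bar e))

  sg-v : ∀ v → ¬ ram v → Fin k
  sg-v v ¬r = sg (proj₁ (out v ¬r))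

  sg-v-o : ∀ e (¬r : ¬ ram (o e)) → sg-v (o e) ¬r ≡ sg e
  sg-v-o e ¬r = sg-at (proj₂ (out (o e) ¬r)) (subst (λ v → ¬ ram v) (sym (proj₂ (out (o e) ¬r))) ¬r)

  lift : {A : Set} → (Fin V → Fin q → A) → Vtx → A
  lift φ y = φ (base y) (sheet y)

  -- Over a ramified vertex `sheet` is an arbitrary representative, so a function of vertex and
  -- sheet is recovered from its lift only if it ignores the sheet there.
  lift-pt : ∀ {A : Set} (φ : Fin V → Fin q → A) → (∀ {v g h} → ram v → φ v g ≡ φ v h) →
            ∀ v g → lift φ (pt v g) ≡ φ v g
  lift-pt φ φ-ram v g rewrite base-pt v g with ram? v
  ... | yes r = φ-ram r
  ... | no ¬r = cong (φ v) (sheet-pt g ¬r)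

  -- The trace of `T` on the copy `g` of the segment `i`, read in X.
  st : Subset (E * q) → Fin k → Fin q → Subset E
  st T i g = tabulate λ e → lookup T (combine e g) ∧ ⌊ sg e ≟ i ⌋

  st⁺ : ∀ {T i g e} → combine e g ∈ T → sg e ≡ i → e ∈ st T i g
  st⁺ {T} {i} {g} {e} x∈ eq =
    ∈-tabulate⁺ (cong₂ _∧_ ([]=⇒lookup x∈) (⌊⌋-true⁺ (sg e ≟ i) eq))

  st⁻ : ∀ {T i g e} → e ∈ st T i g → combine e g ∈ T × sg e ≡ i
  st⁻ {T} {i} {g} {e} e∈ =
    let p , p′ = ∧-true⁻ (∈-tabulate⁻ e∈)
    in lookup⇒[]= _ T p , ⌊⌋-true⁻ (sg e ≟ i) p′

  select : Subset (E * q) → (Fin k → Fin q) → Subset E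
  select T gs = tabulate λ e → lookup T (combine e (gs (sg e)))

  select⁺ : ∀ gs {T e} → combine e (gs (sg e)) ∈ T → e ∈ select T gs
  select⁺ gs = ∈-tabulate⁺ ∘ []=⇒lookup

  select⁻ : ∀ gs {T e} → e ∈ select T gs → combine e (gs (sg e)) ∈ T
  select⁻ gs = lookup⇒[]= _ _ ∘ ∈-tabulate⁻

  in-eb : ∀ {T : Subset (E * q)} {x} → x ∈ T → combine (eb x) (sh x) ∈ T
  in-eb {T} {x} = subst (_∈ T) (sym (combine-eb x))

  module CopyImage (g : Fin q) =
    Image G Y (λ v → pt v g) (λ e x → x ≡ combine e g) (λ _ → ⊥)

  copy-step : ∀ {T i g e} → e ∈ st T i g → CopyImage.Step g (_∈ T) e
  copy-step e∈ = inj₁ (_ , refl , proj₁ (st⁻ e∈) , o-combine _ _ , t-combine _ _)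

  copy-walk : ∀ {T i g u v} → WalkIn G (st T i g) u v → WalkIn Y T (pt u g) (pt v g)
  copy-walk {g = g} = CopyImage.image-walk g LG LY copy-step

  copy-acyclic : ∀ {T} i g → AcyclicIn Y T → AcyclicIn G (st T i g)
  copy-acyclic {T} i g acy (u , e , es , c , in-st , d)
    with CopyImage.image-cycle g T inj (All.map copy-step in-st) c d
    where
    inj : CopyImage.Injectiveᴿ g
    inj refl refl = proj₁ ∘ combine-inj , proj₁ ∘ combine-inj ∘ (λ eq → trans eq (bar-combine _ _))
  ... | inj₁ cyc            = acy cyc
  ... | inj₂ ((() , _) ∷ _)

  closed-copy : ∀ {T e g} → BarClosed Y T → combine e g ∈ T → combine (bar e) g ∈ T
  closed-copy {T} cl x∈ = subst (_∈ T) (bar-combine _ _) (cl _ x∈)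

  st-closed : ∀ {T} i g → BarClosed Y T → BarClosed G (st T i g)
  st-closed i g cl e e∈ = let x∈ , eq = st⁻ e∈ in st⁺ (closed-copy cl x∈) (trans (sg-bar e) eq)

  -- Exchange of spanning trees between X and the cover

  module Exchange (T : Subset (E * q)) (T-closed : BarClosed Y T) (gs : Fin k → Fin q)
                  (forest : ∀ i h → h ≢ gs i → Forest i (st T i h)) where

    T′ : Subset E
    T′ = select T gs

    T′-closed : BarClosed G T′
    T′-closed e e∈ = select⁺ gs (subst (λ i → combine (bar e) (gs i) ∈ T) (sym (sg-bar e))
                       (closed-copy T-closed (select⁻ gs e∈)))

    -- The section places an unramified vertex in the selected copy of its segment. At a ramified
    -- vertex all sheets coincide and `g₀` is a mere default.
    ι-sheet : Fin V → Fin q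
    ι-sheet v with ram? v
    ... | yes _ = g₀
    ... | no ¬r = gs (sg-v v ¬r)

    ι : Fin V → Vtx
    ι v = pt v (ι-sheet v)

    ι-o : ∀ e → ι (o e) ≡ pt (o e) (gs (sg e))
    ι-o e with ram? (o e)
    ... | yes r = pt-ram _ _ r
    ... | no ¬r = cong (pt (o e) ∘ gs) (sg-v-o e ¬r)

    ι-t : ∀ e → ι (t e) ≡ pt (t e) (gs (sg e))
    ι-t = at-t {λ v i → ι v ≡ pt v (gs i)} ι-o

    -- The retraction sends a vertex of an unselected copy to the mark in its forest component, so
    -- that this copy collapses onto its marks; selected copies and ramified vertices stay in place.
    ρ′ : Fin V → Fin q → Fin V
    ρ′ v g with ram? v
    ... | yes _ = v
    ... | no ¬r with g ≟ gs (sg-v v ¬r)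
    ...   | yes _ = v
    ...   | no g≢ = proj₁ (Forest.spans (forest _ g g≢) (proj₁ (out v ¬r)) refl)

    ρ′-ram : ∀ {v g} → ram v → ρ′ v g ≡ v
    ρ′-ram {v} r with ram? v
    ... | yes _ = refl
    ... | no ¬r = ⊥-elim (¬r r)

    ρ : Vtx → Fin V
    ρ = lift ρ′

    ρ-pt : ∀ v g → ρ (pt v g) ≡ ρ′ v g
    ρ-pt = lift-pt ρ′ λ r → trans (ρ′-ram r) (sym (ρ′-ram r))

    ρ′-kept : ∀ e → ρ′ (o e) (gs (sg e)) ≡ o e
    ρ′-kept e with ram? (o e)
    ... | yes _ = refl
    ... | no ¬r with gs (sg e) ≟ gs (sg-v (o e) ¬r)
    ...   | yes _ = refl
    ...   | no g≢ = ⊥-elim (g≢ (cong gs (sym (sg-v-o e ¬r))))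

    Reaches : Fin q → Fin V → Fin k → Set
    Reaches g v i = g ≢ gs i → Mark i (ρ′ v g) × WalkIn G (st T i g) v (ρ′ v g)

    ρ′-reaches : ∀ g e → Reaches g (o e) (sg e)
    ρ′-reaches g e g≢ with ram? (o e)
    ... | yes r = sg-end e r , GW.walk-refl
    ... | no ¬r with g ≟ gs (sg-v (o e) ¬r)
    ...   | yes g≡ = ⊥-elim (g≢ (trans g≡ (cong gs (sg-v-o e ¬r))))
    ...   | no g≢′ with Forest.spans (forest _ g g≢′) (proj₁ (out (o e) ¬r)) refl
    ...     | m , mark , w = subst (λ i → Mark i m) eq mark ,
                subst₂ (λ i v → WalkIn G (st T i g) v m) eq (proj₂ (out (o e) ¬r)) w
      where eq = sg-v-o e ¬r

    ρ-kept : ∀ e → ρ (pt (o e) (gs (sg e))) ≡ o e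
    ρ-kept e = trans (ρ-pt _ _) (ρ′-kept e)

    ρι : ∀ v → ρ (ι v) ≡ v
    ρι v with ram? v
    ... | yes r = trans (ρ-pt _ _) (ρ′-ram r)
    ... | no ¬r with out v ¬r
    ...   | e , refl = ρ-kept e

    -- The two ends of a forest edge lie in one component, which contains a single mark.
    ρ-unkept : ∀ e g → combine e g ∈ T → g ≢ gs (sg e) → ρ (pt (o e) g) ≡ ρ (pt (t e) g)
    ρ-unkept e g x∈ g≢ = trans (ρ-pt _ _) (trans (F.separated mo mt
        (GW.walk-trans (GW.walk-sym F.closed wo)
          (GW.walk-trans (GW.walk-edge e (st⁺ x∈ refl)) wt))) (sym (ρ-pt _ _)))
      where
      module F = Forest (forest (sg e) g g≢)
      mo = proj₁ (ρ′-reaches g e g≢)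
      wo = proj₂ (ρ′-reaches g e g≢)
      mt = proj₁ (at-t {Reaches g} (ρ′-reaches g) e g≢)
      wt = proj₂ (at-t {Reaches g} (ρ′-reaches g) e g≢)

    -- Inside an unselected copy the forest leads to a mark, and over a mark every sheet agrees with
    -- the section.
    to-ιρ : ∀ y → WalkIn Y T y (ι (ρ y))
    to-ιρ y = subst (λ y → WalkIn Y T y (ι (ρ y))) (pt-surj y)
      (subst (λ v → WalkIn Y T (pt (base y) (sheet y)) (ι v)) (sym (ρ-pt _ _)) (go (base y) (sheet y)))
      where
      go : ∀ v g → WalkIn Y T (pt v g) (ι (ρ′ v g))
      go v g with ram? v in eq
      ... | yes r = subst (WalkIn Y T _) (pt-ram g (ι-sheet v) r) YW.walk-refl
      ... | no ¬r with g ≟ gs (sg-v v ¬r)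
      ...   | yes refl = subst (WalkIn Y T _) (cong (pt v) ι-sh) YW.walk-refl
        where
        ι-sh : gs (sg-v v ¬r) ≡ ι-sheet v
        ι-sh rewrite eq = refl
      ...   | no g≢ with Forest.spans (forest _ g g≢) (proj₁ (out v ¬r)) refl
      ...     | m , mark , w = subst₂ (WalkIn Y T) (cong (λ v → pt v g) (proj₂ (out v ¬r)))
                                 (pt-ram _ _ (ram-mark mark)) (copy-walk w)

    module Up = Image G Y ι (λ e x → x ≡ combine e (gs (sg e))) (λ _ → ⊥)

    up-step : ∀ {e} → e ∈ T′ → Up.Step (_∈ T) e
    up-step {e} e∈ = inj₁ (_ , refl , select⁻ gs e∈ ,
      trans (o-combine _ _) (sym (ι-o e)) , trans (t-combine _ _) (sym (ι-t e)))

    module Down = Image Y G ρ (λ x e → x ≡ combine e (gs (sg e))) (λ x → sh x ≢ gs (sg (eb x)))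

    ρ-t : ∀ e → ρ (pt (t e) (gs (sg e))) ≡ t e
    ρ-t = at-t {λ v i → ρ (pt v (gs i)) ≡ v} ρ-kept

    down-step : ∀ {x} → x ∈ T → Down.Step (_∈ T′) x
    down-step {x} x∈ with sh x ≟ gs (sg (eb x))
    ... | yes eq = inj₁ (eb x , trans (sym (combine-eb x)) (cong (combine (eb x)) eq) ,
                    select⁺ gs (subst (λ g → combine (eb x) g ∈ T) eq (in-eb x∈)) ,
                    sym (trans (cong (λ g → ρ (pt (o (eb x)) g)) eq) (ρ-kept (eb x))) ,
                    sym (trans (cong (λ g → ρ (pt (t (eb x)) g)) eq) (ρ-t (eb x))))
    ... | no ne = inj₂ (ne , ρ-unkept (eb x) (sh x) (in-eb x∈) ne)

    down-inj : Down.Injectiveᴿ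
    down-inj refl refl = (λ { refl → refl }) , λ { refl → trans (cong (λ i → combine (bar _) (gs i)) (sg-bar _)) (sym (bar-combine _ _)) }

    -- Connectedness descends along `ρ`, because `ρ` is a left inverse of `ι`. Acyclicity descends
    -- because `ι` lifts a cycle of `T′` edge by edge into `T`.
    tree⇒tree′ : SpanningTree Y T → SpanningTree G T′
    tree⇒tree′ (_ , conn , acy) = T′-closed , conn′ , acy′
      where
      conn′ : ConnectedIn G T′
      conn′ u v = subst₂ (WalkIn G T′) (ρι u) (ρι v) (Down.image-walk LY LG down-step (conn (ι u) (ι v)))
      inj : Up.Injectiveᴿ
      inj refl refl = proj₁ ∘ combine-inj , proj₁ ∘ combine-inj ∘ (λ eq → trans eq (bar-combine _ _))
      acy′ : AcyclicIn G T′
      acy′ (u , e , es , c , in-T′ , d) with Up.image-cycle T inj (All.map up-step in-T′) c d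
      ... | inj₁ cyc            = acy cyc
      ... | inj₂ ((() , _) ∷ _)

    -- Every vertex is connected in `T` to the section, and the section is connected through `T′`. A
    -- cycle of `T` maps under `ρ` to a cycle of `T′` unless all its edges are contracted, the case
    -- that needs the forests.
    tree′⇒tree : SpanningTree G T′ → SpanningTree Y T
    tree′⇒tree (_ , conn , acy) = T-closed , conn′ , acy′
      where
      conn′ : ConnectedIn Y T
      conn′ y z = YW.walk-trans (to-ιρ y)
        (YW.walk-trans (Up.image-walk LG LY up-step (conn (ρ y) (ρ z)))
          (YW.walk-sym T-closed (to-ιρ z)))

      constant : ∀ {m u v} es → Chain Y u es v → All Down.Contracted es → ρ u ≡ m →
                 All (λ x → ρ (Y.o x) ≡ m) es
      constant []       c          []       eq = []
      constant (x ∷ es) (refl , c) (p ∷ ps) eq =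
        eq ∷ constant es c ps (trans (sym (proj₂ p)) eq)

      acy′ : AcyclicIn Y T
      acy′ (u , x₀ , es , c , in-T , d) with Down.image-cycle T′ down-inj (All.map down-step in-T) c d
      ... | inj₁ cyc = acy cyc
      -- The closed trail avoids the selected copies and stays over one mark m:
      -- contract to m all of it that lies outside the copy containing x₀.
      ... | inj₂ contracted = acyclic-copy
        where
        m = ρ u
        i₀ = sg (eb x₀)
        h₀ = sh x₀
        φ : Fin V → Fin q → Fin V
        φ v g with ram? v
        ... | yes _ = m
        ... | no ¬r with (sg-v v ¬r ≟ i₀) ×-dec (g ≟ h₀)
        ...   | yes _ = v
        ...   | no _  = m
        φ-ram : ∀ {v g} → ram v → φ v g ≡ m
        φ-ram {v} r with ram? v
        ... | yes _ = refl
        ... | no ¬r = ⊥-elim (¬r r)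
        -- Since `ρ` fixes ramified vertices, the trail meets none but `m`; sending all of them to
        -- `m` therefore moves no vertex of the trail.
        φ-in : ∀ e → ρ (pt (o e) h₀) ≡ m → sg e ≡ i₀ → φ (o e) h₀ ≡ o e
        φ-in e ρ≡m eq with ram? (o e)
        ... | yes r = trans (sym ρ≡m) (trans (ρ-pt _ _) (ρ′-ram r))
        ... | no ¬r with (sg-v (o e) ¬r ≟ i₀) ×-dec (h₀ ≟ h₀)
        ...   | yes _ = refl
        ...   | no ne = ⊥-elim (ne (trans (sg-v-o e ¬r) eq , refl))
        φ-out : ∀ e g → ¬ (sg e ≡ i₀ × g ≡ h₀) → φ (o e) g ≡ m
        φ-out e g ne with ram? (o e)
        ... | yes r = refl
        ... | no ¬r with (sg-v (o e) ¬r ≟ i₀) ×-dec (g ≟ h₀)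
        ...   | yes (eq , g≡) = ⊥-elim (ne (trans (sym (sg-v-o e ¬r)) eq , g≡))
        ...   | no _ = refl
        φ-pt = lift-pt φ λ r → trans (φ-ram r) (sym (φ-ram r))
        module One = Image Y G (lift φ) (λ x e → x ≡ combine e h₀) (λ x → ¬ (sg (eb x) ≡ i₀ × sh x ≡ h₀))
        one-step : ∀ {x} → x ∈ T × Down.Contracted x × ρ (Y.o x) ≡ m → One.Step (_∈ st T i₀ h₀) x
        one-step {x} (x∈ , (_ , ρ≡) , ρo≡m) with (sg (eb x) ≟ i₀) ×-dec (sh x ≟ h₀)
        ... | no ne = inj₂ (ne , trans (trans (φ-pt _ _) (φ-out (eb x) (sh x) ne))
            (sym (trans (φ-pt _ _) (at-t {λ v i → ¬ (i ≡ i₀ × sh x ≡ h₀) → φ v (sh x) ≡ m}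
                                      (λ e → φ-out e (sh x)) (eb x) ne))))
        ... | yes (eq , g≡) = inj₁ (eb x , trans (sym (combine-eb x)) (cong (combine (eb x)) g≡) ,
            st⁺ (subst (λ g → combine (eb x) g ∈ T) g≡ (in-eb x∈)) eq ,
            sym (trans (cong (λ g → lift φ (pt (o (eb x)) g)) g≡) (trans (φ-pt _ _)
              (φ-in (eb x) (subst (λ g → ρ (pt (o (eb x)) g) ≡ m) g≡ ρo≡m) eq))) ,
            sym (trans (cong (λ g → lift φ (pt (t (eb x)) g)) g≡) (trans (φ-pt _ _)
              (at-t {λ v i → ρ (pt v h₀) ≡ m → i ≡ i₀ → φ v h₀ ≡ v} φ-in (eb x)
                 (subst (λ g → ρ (pt (t (eb x)) g) ≡ m) g≡ (trans (sym ρ≡) ρo≡m)) eq))))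
        one-inj : One.Injectiveᴿ
        one-inj refl refl = (λ { refl → refl }) , λ { refl → sym (bar-combine _ _) }
        acyclic-copy : ⊥
        acyclic-copy with One.image-cycle (st T i₀ h₀) one-inj
            (All.map one-step (All.zip (in-T , All.zip (contracted , constant (x₀ ∷ es) c contracted refl)))) c d
        ... | inj₁ cyc = Forest.acyclic (forest i₀ h₀ (proj₁ (All.head contracted))) cyc
        -- The trail starts with `x₀`, which lies in the copy that is kept, so it is not contracted
        -- entirely.
        ... | inj₂ ((ne , _) ∷ _) = ne (refl , refl)

  -- Traces of a spanning tree of the cover

  ¬joined⇒separated : ∀ {i F} → BarClosed G F → ¬ Joined i F →
                      ∀ {m m′} → Mark i m → Mark i m′ → WalkIn G F m m′ → m ≡ m′
  ¬joined⇒separated cl ¬j (inj₁ refl) (inj₁ refl) w = refl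
  ¬joined⇒separated cl ¬j (inj₂ refl) (inj₂ refl) w = refl
  ¬joined⇒separated {i} cl ¬j (inj₁ refl) (inj₂ refl) w with a i ≟ b i
  ... | yes eq = eq
  ... | no ne  = ⊥-elim (¬j (ne , w))
  ¬joined⇒separated {i} cl ¬j (inj₂ refl) (inj₁ refl) w with a i ≟ b i
  ... | yes eq = sym eq
  ... | no ne  = ⊥-elim (¬j (ne , GW.walk-sym cl w))

  forest⇒¬joined : ∀ {i F} → Forest i F → ¬ Joined i F
  forest⇒¬joined Fo (ne , w) = ne (Forest.separated Fo (inj₁ refl) (inj₂ refl) w)

  -- The walk is followed up to its first ramified vertex. Until then it cannot leave the copy,
  -- because sheet and segment change only at ramified vertices.
  first-mark : ∀ {T g y} e es → ¬ ram (o e) → Chain Y (pt (o e) g) es y → All (_∈ T) es → ram (base y) →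
               ∃ λ m → Mark (sg e) m × WalkIn G (st T (sg e) g) (o e) m
  first-mark e []       ¬r refl     []         r = ⊥-elim (¬r (subst ram (base-pt _ _) r))
  first-mark {T} {g} {y} e (x ∷ es) ¬r (ox , c) (x∈ ∷ xs∈) r = go (ram? (t f))
    where
    f = eb x
    of : o f ≡ o e
    of = trans (sym (base-pt _ _)) (trans (cong base ox) (base-pt _ _))
    ¬rf : ¬ ram (o f)
    ¬rf = ¬r ∘ subst ram of
    sh≡ : sh x ≡ g
    sh≡ = trans (sym (sheet-pt (sh x) ¬rf)) (trans (cong sheet ox) (sheet-pt g ¬r))
    sg≡ : sg f ≡ sg e
    sg≡ = sg-at of ¬rf
    step : WalkIn G (st T (sg e) g) (o e) (t f)
    step = subst (λ v → WalkIn G (st T (sg e) g) v (t f)) of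
             (GW.walk-edge f (st⁺ (subst (λ g → combine f g ∈ T) sh≡ (in-eb x∈)) sg≡))
    Goal = ∃ λ m → Mark (sg e) m × WalkIn G (st T (sg e) g) (o e) m
    go : Dec (ram (t f)) → Goal
    go (yes r′) = t f , subst (λ i → Mark i (t f)) sg≡ (at-t {λ v i → ram v → Mark i v} sg-end f r′) , step
    go (no ¬r′) with first-mark (bar f) es (¬r′ ∘ subst ram (GL.o-bar f))
                      (subst₂ (λ v g → Chain Y (pt v g) es y) (sym (GL.o-bar f)) sh≡ c) xs∈ r
    ... | m , mark , w = m , subst (λ i → Mark i m) sgb mark ,
            GW.walk-trans step (subst₂ (λ i v → WalkIn G (st T i g) v m) sgb (GL.o-bar f) w)
      where sgb = trans (sg-bar f) sg≡

  -- The copies are glued at both marks, so joining walks in two different copies would close up to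
  -- a cycle.
  joined-once : ∀ {T i g h} → AcyclicIn Y T → BarClosed Y T → Joined i (st T i g) → Joined i (st T i h) → g ≡ h
  joined-once {T} {i} {g} {h} acy cl (a≢b , w) (_ , w′) with g ≟ h
  ... | yes eq = eq
  ... | no g≢h = ⊥-elim (acy (YW.two-walks⇒cycle {P = On g} {Q = On h} T proj₁ proj₁
      (λ { (_ , refl) (_ , refl) → (λ { refl → g≢h refl }) , (λ eq → g≢h (trans (cong sh eq) (sh-combine _ _))) })
      (λ eq → a≢b (trans (sym (base-pt _ _)) (trans (cong base eq) (base-pt _ _))))
      (CopyImage.image-walk g LG LY step w)
      (subst₂ (YW.Walk (On h)) (pt-ram h g (ram-b i)) (pt-ram h g (ram-a i))
         (CopyImage.image-walk h LG LY step (GW.walk-sym (st-closed i h cl) w′)))))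
    where
    On : Fin q → Fin (E * q) → Set
    On g x = x ∈ T × sh x ≡ g
    step : ∀ {g e} → e ∈ st T i g → CopyImage.Step g (On g) e
    step e∈ = inj₁ (_ , refl , (proj₁ (st⁻ e∈) , sh-combine _ _) , o-combine _ _ , t-combine _ _)

  -- The entry at the selected copy is forced by `T′` and contributes a factor 1; keeping it lets
  -- the traces be indexed by all `q` copies.
  SegCode : Subset E → (i : Fin k) → Fin q → Fin q → Subset E → Set
  SegCode T′ i g h S = (h ≡ g → S ≡ part T′ i) × (h ≢ g → Forest i S)

  Code : Set
  Code = Subset E × Vec (Fin q × Vec (Subset E) q) k

  -- T′ is the selected spanning tree of X and (g , s) the selected copy of a
  -- segment with the traces on all its copies; the selection is forced to g₀
  -- when the segment does not join its marks, so that a tree has one code only.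
  ValidAt : Subset E → (i : Fin k) → Fin q × Vec (Subset E) q → Set
  ValidAt T′ i (g , s) = (Joined i (part T′ i) ⊎ g ≡ g₀) × (∀ h → SegCode T′ i g h (lookup s h))

  Valid : Code → Set
  Valid (T′ , c) = SpanningTree G T′ × (∀ i → ValidAt T′ i (lookup c i))

  chosen : Code → Fin k → Fin q
  chosen (_ , c) i = proj₁ (lookup c i)

  trace : Code → Fin k → Fin q → Subset E
  trace (_ , c) i h = lookup (proj₂ (lookup c i)) h

  decode : Code → Subset (E * q)
  decode c = tabulate λ x → lookup (trace c (sg (eb x)) (sh x)) (eb x)

  decode⁺ : ∀ c {e g} → e ∈ trace c (sg e) g → combine e g ∈ decode c
  decode⁺ c {e} {g} e∈ = ∈-tabulate⁺
    (trans (cong₂ (λ e g → lookup (trace c (sg e) g) e) (eb-combine e g) (sh-combine e g)) ([]=⇒lookup e∈))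

  decode⁻ : ∀ c {e g} → combine e g ∈ decode c → e ∈ trace c (sg e) g
  decode⁻ c {e} {g} x∈ = lookup⇒[]= e _
    (trans (sym (cong₂ (λ e g → lookup (trace c (sg e) g) e) (eb-combine e g) (sh-combine e g))) (∈-tabulate⁻ x∈))

  module _ (c : Code) (valid : Valid c) where
    private
      T′ = proj₁ c
      at = proj₂ valid

    trace-chosen : ∀ i → trace c i (chosen c i) ≡ part T′ i
    trace-chosen i = proj₁ (proj₂ (at i) (chosen c i)) refl

    trace-forest : ∀ i h → h ≢ chosen c i → Forest i (trace c i h)
    trace-forest i h = proj₂ (proj₂ (at i) h)

    trace-inside : ∀ {i h e} → e ∈ trace c i h → sg e ≡ i
    trace-inside {i} {h} e∈ with h ≟ chosen c i
    ... | yes refl = proj₂ (part⁻ {T′} (subst (_ ∈_) (trace-chosen i) e∈))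
    ... | no ne    = Forest.inside (trace-forest i h ne) e∈

    trace-closed : ∀ i h → BarClosed G (trace c i h)
    trace-closed i h with h ≟ chosen c i
    ... | yes refl = subst (BarClosed G) (sym (trace-chosen i)) (part-closed i (proj₁ (proj₁ valid)))
    ... | no ne    = Forest.closed (trace-forest i h ne)

    st-decode : ∀ i h → st (decode c) i h ≡ trace c i h
    st-decode i h = Subset-ext
      (λ e e∈ → let x∈ , eq = st⁻ e∈ in subst (λ i → e ∈ trace c i h) eq (decode⁻ c x∈))
      (λ e e∈ → let eq = trace-inside e∈ in st⁺ (decode⁺ c (subst (λ i → e ∈ trace c i h) (sym eq) e∈)) eq)

    select-decode : select (decode c) (chosen c) ≡ T′
    select-decode = Subset-ext
      (λ e e∈ → proj₁ (part⁻ {T′} (subst (e ∈_) (trace-chosen (sg e)) (decode⁻ c (select⁻ (chosen c) e∈)))))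
      (λ e e∈ → select⁺ (chosen c) (decode⁺ c (subst (e ∈_) (sym (trace-chosen (sg e))) (part⁺ e∈ refl))))

    decode-closed : BarClosed Y (decode c)
    decode-closed x x∈ = decode⁺ c (subst (λ i → bar (eb x) ∈ trace c i (sh x)) (sym (sg-bar (eb x)))
      (trace-closed _ _ _ (decode⁻ c (in-eb x∈))))

    decode-tree : SpanningTree Y (decode c)
    decode-tree = Exchange.tree′⇒tree (decode c) decode-closed (chosen c)
      (λ i h ne → subst (Forest i) (sym (st-decode i h)) (trace-forest i h ne))
      (subst (SpanningTree G) (sym select-decode) (proj₁ valid))

    chosen-joined : ∀ {i} → Joined i (part T′ i) → Joined i (trace c i (chosen c i))
    chosen-joined {i} = subst (Joined i) (sym (trace-chosen i))

  -- If the selections differ, the copy selected by one code carries a forest according to the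
  -- other, hence does not join the marks. Both selections are then forced to `g₀`.
  chosen-unique : ∀ c d → Valid c → Valid d → (∀ i h → trace c i h ≡ trace d i h) →
                  ∀ i → chosen c i ≡ chosen d i
  chosen-unique c d vc vd tr i with chosen c i ≟ chosen d i
  ... | yes eq = eq
  ... | no ne = trans (at₀ c d vc vd tr ne) (sym (at₀ d c vd vc (λ i h → sym (tr i h)) (ne ∘ sym)))
    where
    at₀ : ∀ c d → Valid c → Valid d → (∀ i h → trace c i h ≡ trace d i h) →
          chosen c i ≢ chosen d i → chosen c i ≡ g₀
    at₀ c d vc vd tr ne with proj₁ (proj₂ vc i)
    ... | inj₂ eq = eq
    ... | inj₁ j  = ⊥-elim (forest⇒¬joined (trace-forest d vd i (chosen c i) ne)
                      (subst (Joined i) (tr i (chosen c i)) (chosen-joined c vc j)))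

  decode-injective : ∀ c d → Valid c → Valid d → decode c ≡ decode d → c ≡ d
  decode-injective c d vc vd eq = cong₂ _,_
    (trans (sym (select-decode c vc)) (trans (cong (λ T → select T (chosen c)) eq)
      (trans (Subset-ext (λ e e∈ → select⁺ (chosen d) (subst (λ g → combine e g ∈ decode d) (ch (sg e)) (select⁻ (chosen c) e∈)))
                         (λ e e∈ → select⁺ (chosen c) (subst (λ g → combine e g ∈ decode d) (sym (ch (sg e))) (select⁻ (chosen d) e∈))))
             (select-decode d vd))))
    (lookup-ext λ i → cong₂ _,_ (ch i) (lookup-ext (tr i)))
    where
    tr : ∀ i h → trace c i h ≡ trace d i h
    tr i h = trans (sym (st-decode c vc i h)) (trans (cong (λ T → st T i h) eq) (st-decode d vd i h))
    ch = chosen-unique c d vc vd tr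

  module _ (walk? : ∀ S u v → Dec (WalkIn G S u v)) {r₀ : Fin V} (ram-r₀ : ram r₀) where

    joined? : ∀ i F → Dec (Joined i F)
    joined? i F = ¬? (a i ≟ b i) ×-dec walk? F (a i) (b i)

    module Encode (T : Subset (E * q)) (tree : SpanningTree Y T) where
      private
        cl  = proj₁ tree
        conn = proj₁ (proj₂ tree)
        acy = proj₂ (proj₂ tree)

      st-forest : ∀ i h → ¬ Joined i (st T i h) → Forest i (st T i h)
      st-forest i h ¬j = record
        { inside = λ e∈ → proj₂ (st⁻ {T} {i} {h} e∈) ; closed = st-closed i h cl ; acyclic = copy-acyclic i h acy
        ; spans = λ { e refl → spans e (ram? (o e)) }
        ; separated = ¬joined⇒separated (st-closed i h cl) ¬j }
        where
        spans : ∀ e → Dec (ram (o e)) → ∃ λ m → Mark (sg e) m × WalkIn G (st T (sg e) h) (o e) m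
        spans e (yes r) = o e , sg-end e r , GW.walk-refl
        -- Any ramified vertex serves as the goal, as the walk is used only up to its first ramified
        -- vertex.
        spans e (no ¬r) with conn (pt (o e) h) (pt r₀ h)
        ... | es , c , es∈ = first-mark e es ¬r c es∈ (subst ram (sym (base-pt _ _)) ram-r₀)

      choice : ∀ i → Σ (Fin q) λ g → (Joined i (st T i g) ⊎ g ≡ g₀) × (∀ h → h ≢ g → Forest i (st T i h))
      choice i with any? (λ g → joined? i (st T i g))
      ... | yes (g , j) = g , inj₁ j , λ h h≢g → st-forest i h λ j′ → h≢g (joined-once acy cl j′ j)
      ... | no ¬j = g₀ , inj₂ refl , λ h _ → st-forest i h λ j → ¬j (h , j)

      gs : Fin k → Fin q
      gs i = proj₁ (choice i)

      open Exchange T cl gs (λ i → proj₂ (proj₂ (choice i))) using (T′; tree⇒tree′)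

      st-chosen : ∀ i → st T i (gs i) ≡ part T′ i
      st-chosen i = Subset-ext
        (λ e e∈ → let x∈ , eq = st⁻ e∈ in part⁺ (select⁺ gs (subst (λ i → combine e (gs i) ∈ T) (sym eq) x∈)) eq)
        (λ e e∈ → let e∈T′ , eq = part⁻ e∈ in st⁺ (subst (λ i → combine e (gs i) ∈ T) eq (select⁻ gs e∈T′)) eq)

      codeAt : Fin k → Fin q × Vec (Subset E) q
      codeAt i = gs i , tabulate (st T i)

      code : Code
      code = T′ , tabulate codeAt

      validAt : ∀ i → ValidAt T′ i (codeAt i)
      validAt i = [ inj₁ ∘ subst (Joined i) (st-chosen i) , inj₂ ]′ (proj₁ (proj₂ (choice i))) ,
        λ h → subst (SegCode T′ i (gs i) h) (sym (lookup∘tabulate (st T i) h))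
                ((λ { refl → st-chosen i }) , proj₂ (proj₂ (choice i)) h)

      code-valid : Valid code
      code-valid = tree⇒tree′ tree , λ i → subst (ValidAt T′ i) (sym (lookup∘tabulate codeAt i)) (validAt i)

      trace-code : ∀ i h → trace code i h ≡ st T i h
      trace-code i h = trans (cong (λ p → lookup (proj₂ p) h) (lookup∘tabulate codeAt i)) (lookup∘tabulate (st T i) h)

      decode-code : decode code ≡ T
      decode-code = Subset-ext
        (λ x x∈ → subst (_∈ T) (combine-eb x) (proj₁ (st⁻ (subst (eb x ∈_) (trace-code _ _) (decode⁻ code (in-eb x∈))))))
        (λ x x∈ → subst (_∈ decode code) (combine-eb x)
                    (decode⁺ code (subst (eb x ∈_) (sym (trace-code _ _)) (st⁺ (in-eb x∈) refl))))

-- Counting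

-- Elements are compared but proofs of `P` are not, so `P` need not be a proposition.
record Enum {A : Set} (P : A → Set) (n : ℕ) : Set where
  field
    enum     : Fin n → A
    inj      : ∀ {i j} → enum i ≡ enum j → i ≡ j
    sound    : ∀ i → P (enum i)
    complete : ∀ {x} → P x → ∃ λ i → enum i ≡ x

lookup-unique : ∀ {A : Set} {xs : List A} → Unique xs → ∀ i j → List.lookup xs i ≡ List.lookup xs j → i ≡ j
lookup-unique (_ ∷ _)  zero    zero    _  = refl
lookup-unique (n ∷ _)  zero    (suc j) eq = ⊥-elim (All.lookup n (LMem.∈-lookup j) eq)
lookup-unique (n ∷ _)  (suc i) zero    eq = ⊥-elim (All.lookup n (LMem.∈-lookup i) (sym eq))
lookup-unique (_ ∷ uq) (suc i) (suc j) eq = cong suc (lookup-unique uq i j eq)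

enum-count : ∀ {A : Set} {P : A → Set} {n} → IsCount P n → Enum P n
enum-count (xs , uq , refl , iff) = record
  { enum = List.lookup xs ; inj = lookup-unique uq _ _
  ; sound = λ i → proj₁ (iff _) (LMem.∈-lookup i)
  ; complete = λ p → let x∈ = proj₂ (iff _) p in Any.index x∈ , sym (Any.lookup-index x∈) }

module _ {A B : Set} {P : A → Set} {Q : B → Set} where

  enum-map : ∀ {n} → Enum P n → (f : A → B) → (∀ {x} → P x → Q (f x)) →
             (∀ {x y} → P x → P y → f x ≡ f y → x ≡ y) →
             (∀ {y} → Q y → ∃ λ x → P x × f x ≡ y) → Enum Q n
  enum-map EP f f-P f-inj f-surj = record
    { enum = f ∘ enum ; inj = λ {i} {j} → inj ∘ f-inj (sound i) (sound j) ; sound = f-P ∘ sound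
    ; complete = λ q → let x , p , eq = f-surj q ; i , eq′ = complete p in i , trans (cong f eq′) eq }
    where open Enum EP

enum-iff : ∀ {A : Set} {P Q : A → Set} {n} → (∀ {x} → P x → Q x) → (∀ {x} → Q x → P x) → Enum P n → Enum Q n
enum-iff f g EP = enum-map EP id f (λ _ _ eq → eq) (λ q → _ , g q , refl)

enum-unique : ∀ {A : Set} {P : A → Set} {m n} → Enum P m → Enum P n → m ≡ n
enum-unique {P = P} EP EQ = cantor-schröder-bernstein (match-inj EP EQ) (match-inj EQ EP)
  where
  match : ∀ {m n} → Enum P m → Enum P n → Fin m → Fin n
  match EP EQ i = proj₁ (Enum.complete EQ (Enum.sound EP i))
  match-inj : ∀ {m n} (EP : Enum P m) (EQ : Enum P n) {i j} → match EP EQ i ≡ match EP EQ j → i ≡ j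
  match-inj EP EQ {i} {j} eq = Enum.inj EP
    (trans (sym (proj₂ (Enum.complete EQ (Enum.sound EP i))))
      (trans (cong (Enum.enum EQ) eq) (proj₂ (Enum.complete EQ (Enum.sound EP j)))))

-- The fibre may vary with `x`; only its size must be constant, as for the codes over a given
-- spanning tree.
enum-Σ : ∀ {A B : Set} {P : A → Set} {Q : A → B → Set} {m n} → Enum P m → (∀ {x} → P x → Enum (Q x) n) →
         Enum (λ (xy : A × B) → P (proj₁ xy) × Q (proj₁ xy) (proj₂ xy)) (m * n)
enum-Σ {A} {B} {P} {Q} {m} {n} EP EQ = record
  { enum = λ z → pair (proj₁ (remQuot {m} n z)) (proj₂ (remQuot {m} n z))
  ; inj = λ {z} {z′} eq → trans (sym (combine-remQuot {m} n z))
            (trans (pair-inj eq) (combine-remQuot {m} n z′))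
  ; sound = λ z → EP.sound _ , Enum.sound (EQ (EP.sound _)) _
  ; complete = λ { {x , y} (p , q) → find (EP.complete p) q } }
  where
  module EP = Enum EP
  pair : Fin m → Fin n → A × B
  pair i j = EP.enum i , Enum.enum (EQ (EP.sound i)) j
  pair-inj : ∀ {i j i′ j′} → pair i j ≡ pair i′ j′ → combine i j ≡ combine i′ j′
  pair-inj {i} eq with EP.inj (cong proj₁ eq)
  ... | refl = cong (combine {m} {n} i) (Enum.inj (EQ (EP.sound _)) (cong proj₂ eq))
  find : ∀ {x y} → (∃ λ i → EP.enum i ≡ x) → Q x y →
         ∃ λ z → pair (proj₁ (remQuot {m} n z)) (proj₂ (remQuot {m} n z)) ≡ (x , y)
  find (i , refl) q with Enum.complete (EQ (EP.sound i)) q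
  ... | j , eq = combine i j , trans (cong (uncurry pair) (remQuot-combine {m} i j)) (cong (EP.enum i ,_) eq)

enum-Vec : ∀ {A : Set} n {P : Fin n → A → Set} {c : Fin n → ℕ} → (∀ i → Enum (P i) (c i)) →
           Enum (λ (v : Vec A n) → ∀ i → P i (lookup v i)) (prodFin n c)
enum-Vec zero    E = record
  { enum = λ _ → [] ; inj = λ { {zero} {zero} _ → refl } ; sound = λ _ () ; complete = λ { {[]} _ → zero , refl } }
enum-Vec (suc n) E = enum-map (enum-Σ (E zero) (λ _ → enum-Vec n (E ∘ suc))) (uncurry _∷_)
  (λ { (p , ps) → λ { zero → p ; (suc i) → ps i } })
  (λ { {x , xs} {y , ys} _ _ refl → refl })
  (λ { {x ∷ xs} ps → (x , xs) , (ps zero , ps ∘ suc) , refl })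

enum-≡ : ∀ {A : Set} (x : A) → Enum (_≡ x) 1
enum-≡ x = record { enum = λ _ → x ; inj = λ { {zero} {zero} _ → refl } ; sound = λ _ → refl
                  ; complete = λ eq → zero , sym eq }

enum-Fin : ∀ {n} {P : Fin n → Set} → (∀ i → P i) → Enum P n
enum-Fin p = record { enum = id ; inj = id ; sound = p ; complete = λ {i} _ → i , refl }

enum-Bool : {P : Bool → Set} → (∀ b → P b) → Enum P 2
enum-Bool {P} p = record
  { enum = toBool ; inj = λ { {zero} {zero} _ → refl ; {suc zero} {suc zero} _ → refl
                            ; {zero} {suc zero} () ; {suc zero} {zero} () }
  ; sound = λ _ → p _ ; complete = λ { {true} _ → zero , refl ; {false} _ → suc zero , refl } }
  where
  toBool : Fin 2 → Bool
  toBool zero    = true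
  toBool (suc _) = false

-- A free choice if `K` holds and a forced value otherwise: both the selected copy of a segment and
-- its coefficient over 𝔽₂ have this form.
enum-⊎≡ : ∀ {A K : Set} {n} (K? : Dec K) (x₀ : A) → (∀ {P : A → Set} → (∀ x → P x) → Enum P n) →
          Enum (λ x → K ⊎ x ≡ x₀) (if does K? then n else 1)
enum-⊎≡ (yes κ) x₀ E = E λ _ → inj₁ κ
enum-⊎≡ (no ¬κ) x₀ E = enum-iff inj₂ [ ⊥-elim ∘ ¬κ , id ]′ (enum-≡ x₀)

prodFin-const : ∀ n c → prodFin n (λ _ → c) ≡ c ^ n
prodFin-const zero    c = refl
prodFin-const (suc n) c = cong (c *_) (prodFin-const n c)

prodFin-* : ∀ n (f g : Fin n → ℕ) → prodFin n (λ i → f i * g i) ≡ prodFin n f * prodFin n g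
prodFin-* zero    f g = refl
prodFin-* (suc n) f g = trans (cong (f zero * g zero *_) (prodFin-* n (f ∘ suc) (g ∘ suc)))
  (ℕ.[m*n]*[o*p]≡[m*o]*[n*p] (f zero) (g zero) _ _)

prodFin-except : ∀ {n} (g : Fin n) c → prodFin n (λ h → if does (h ≟ g) then 1 else c) ≡ c ^ (n ∸ 1)
prodFin-except {suc n}       zero    c = trans (ℕ.*-identityˡ _) (prodFin-const n c)
prodFin-except {suc (suc n)} (suc g) c = cong (c *_) (prodFin-except g c)

module _ {A B : Set} {x y : B} where
  if-yes : (d : Dec A) → A → (if does d then x else y) ≡ x
  if-yes (yes _) _ = refl
  if-yes (no ¬a) a = ⊥-elim (¬a a)

  if-no : (d : Dec A) → ¬ A → (if does d then x else y) ≡ y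
  if-no (yes a) ¬a = ⊥-elim (¬a a)
  if-no (no _)  _  = refl

trues : ∀ n → (Fin n → Bool) → ℕ
trues zero    f = 0
trues (suc n) f = (if f zero then 1 else 0) + trues n (f ∘ suc)

prodFin-if : ∀ n (f : Fin n → Bool) c → prodFin n (λ i → if f i then c else 1) ≡ c ^ trues n f
prodFin-if zero    f c = refl
prodFin-if (suc n) f c with f zero
... | true  = cong (c *_) (prodFin-if n (f ∘ suc) c)
... | false = trans (ℕ.*-identityˡ _) (prodFin-if n (f ∘ suc) c)

2^-injective : ∀ {m n} → 2 ^ m ≡ 2 ^ n → m ≡ n
2^-injective {m} {n} eq with ℕ.<-cmp m n
... | tri< m<n _ _ = ⊥-elim (ℕ.<⇒≢ (ℕ.^-monoʳ-< 2 (s≤s (s≤s z≤n)) m<n) eq)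
... | tri≈ _ m≡n _ = m≡n
... | tri> _ _ n<m = ⊥-elim (ℕ.<⇒≢ (ℕ.^-monoʳ-< 2 (s≤s (s≤s z≤n)) n<m) (sym eq))

-- Sums over 𝔽₂

xorFin : ∀ n → (Fin n → Bool) → Bool
xorFin zero    f = false
xorFin (suc n) f = f zero xor xorFin n (f ∘ suc)

xor-interchange : ∀ x y z w → (x xor y) xor (z xor w) ≡ (x xor z) xor (y xor w)
xor-interchange x y z w = trans (xor-assoc x y _) (trans (cong (x xor_)
  (trans (sym (xor-assoc y z w)) (trans (cong (_xor w) (xor-comm y z)) (xor-assoc z y w))))
  (sym (xor-assoc x z _)))

xor-cancelʳ : ∀ x y → (x xor y) xor y ≡ x
xor-cancelʳ x y = trans (xor-assoc x y y) (trans (cong (x xor_) (xor-same y)) (xor-identityʳ x))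

xor-cancel₀ : ∀ c x y → (c xor x) xor (c xor y) ≡ x xor y
xor-cancel₀ c x y = trans (xor-interchange c x c y) (cong (_xor (x xor y)) (xor-same c))

xorFin-xor : ∀ n (f g : Fin n → Bool) → xorFin n f xor xorFin n g ≡ xorFin n (λ i → f i xor g i)
xorFin-xor zero    f g = refl
xorFin-xor (suc n) f g = trans (xor-interchange (f zero) _ (g zero) _)
  (cong ((f zero xor g zero) xor_) (xorFin-xor n (f ∘ suc) (g ∘ suc)))

xorFin-false : ∀ n (f : Fin n → Bool) → (∀ i → f i ≡ false) → xorFin n f ≡ false
xorFin-false zero    f eq = refl
xorFin-false (suc n) f eq = cong₂ _xor_ (eq zero) (xorFin-false n (f ∘ suc) (eq ∘ suc))

xorFin-single : ∀ {n} (f : Fin n → Bool) j → (∀ i → i ≢ j → f i ≡ false) → xorFin n f ≡ f j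
xorFin-single {suc n} f zero    eq =
  trans (cong (f zero xor_) (xorFin-false n (f ∘ suc) λ i → eq (suc i) λ ())) (xor-identityʳ _)
xorFin-single {suc n} f (suc j) eq = cong₂ _xor_ (eq zero λ ())
  (xorFin-single (f ∘ suc) j λ i i≢j → eq (suc i) λ { refl → i≢j refl })

-- The number of segments joined by a spanning tree

module TreeCut {V E : ℕ} (X : FinGraph V E) (isG : IsGraph X) (ram : Fin V → Set)
               (Sg : Segmentation X ram) (walk? : ∀ S u v → Dec (WalkIn (toPre X) S u v))
               (T : Subset E) (tree : SpanningTree (toPre X) T) where
  open FinGraph X
  open Segmentation Sg
  open Walks (toPre X) (lawful isG)
  open Lawful (lawful isG)

  private
    G = toPre X

  J : Fin k → Set
  J i = Joined i (part T i)

  J? : ∀ i → Dec (J i)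
  J? i = ¬? (a i ≟ b i) ×-dec walk? (part T i) (a i) (b i)

  T-part-closed : ∀ i → BarClosed G (part T i)
  T-part-closed i = part-closed i (proj₁ tree)

  without : Fin k → Subset E
  without i = tabulate λ e → lookup T e ∧ ⌊ ¬? (sg e ≟ i) ⌋

  without⁺ : ∀ {i e} → e ∈ T → sg e ≢ i → e ∈ without i
  without⁺ {i} {e} e∈ ne = ∈-tabulate⁺ (cong₂ _∧_ ([]=⇒lookup e∈) (⌊⌋-true⁺ (¬? (sg e ≟ i)) ne))

  without⁻ : ∀ {i e} → e ∈ without i → e ∈ T × sg e ≢ i
  without⁻ {i} {e} e∈ =
    let p , p′ = ∧-true⁻ (∈-tabulate⁻ e∈)
    in lookup⇒[]= _ T p , ⌊⌋-true⁻ (¬? (sg e ≟ i)) p′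

  -- The fundamental cut of a segment: the indicator of the component of `a i` once the edges of the
  -- segment are deleted from `T`.
  cut : Fin k → Fin V → Bool
  cut i v = ⌊ walk? (without i) (a i) v ⌋

  cut-a : ∀ i → cut i (a i) ≡ true
  cut-a i = ⌊⌋-true⁺ (walk? _ _ _) walk-refl

  -- A walk from `a i` to `b i` outside the segment and the joining walk inside it would close up to
  -- a cycle of `T`.
  cut-b : ∀ i → J i → cut i (b i) ≡ false
  cut-b i (a≢b , w) with walk? (without i) (a i) (b i)
  ... | no _ = refl
  ... | yes w′ = ⊥-elim (proj₂ (proj₂ tree) (two-walks⇒cycle T (proj₁ ∘ without⁻) (proj₁ ∘ part⁻ {T})
      (λ {e} {f} p q → (λ { refl → proj₂ (without⁻ {i} p) (proj₂ (part⁻ {T} q)) }) ,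
               (λ { refl → proj₂ (without⁻ {i} p) (trans (sg-bar f) (proj₂ (part⁻ {T} q))) }))
      a≢b w′ (walk-sym (T-part-closed i) w)))

  cut-other : ∀ i j → i ≢ j → J j → cut i (a j) ≡ cut i (b j)
  cut-other i j i≢j (_ , w) = ≡true-iff
    (λ p → ⌊⌋-true⁺ (walk? _ _ _) (walk-trans (⌊⌋-true⁻ (walk? _ _ _) p) (walk-map avoid w)))
    (λ p → ⌊⌋-true⁺ (walk? _ _ _) (walk-trans (⌊⌋-true⁻ (walk? _ _ _) p)
             (walk-map avoid (walk-sym (T-part-closed j) w))))
    where
    avoid : ∀ {e} → e ∈ part T j → e ∈ without i
    avoid e∈ = let e∈T , eq = part⁻ {T} e∈ in without⁺ e∈T λ eq′ → i≢j (trans (sym eq′) eq)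

  potential : (Fin k → Bool) → Fin V → Bool
  potential x v = xorFin k λ i → x i ∧ cut i v

  -- Crossing the joined segment `j` changes the cut of `j` and no other, so the coefficients on
  -- joined segments can be recovered from the potential.
  potential-δ : ∀ x j → J j → potential x (a j) xor potential x (b j) ≡ x j
  potential-δ x j jn = trans (xorFin-xor k _ _) (trans (xorFin-single _ j other) self)
    where
    other : ∀ i → i ≢ j → (x i ∧ cut i (a j)) xor (x i ∧ cut i (b j)) ≡ false
    other i i≢j rewrite cut-other i j i≢j jn = xor-same (x i ∧ cut i (b j))
    self : (x j ∧ cut j (a j)) xor (x j ∧ cut j (b j)) ≡ x j
    self rewrite cut-a j | cut-b j jn | ∧-identityʳ (x j) | ∧-zeroʳ (x j) = xor-identityʳ (x j)

  -- The ramified vertices on a walk in `T` cut it into pieces that stay within one segment. Each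
  -- piece connects two marks that are equal or joined, so `d` agrees at its ends.
  constant : ∀ {A : Set} (d : Fin V → A) → (∀ i → J i → d (a i) ≡ d (b i)) →
             ∀ {u v} → ram u → ram v → d u ≡ d v
  constant {A} d d-J {u} {v} ru rv = let es , c , es∈ = proj₁ (proj₂ tree) u v in proj₁ (along es c es∈) ru
    where
    marks : ∀ {i m m′} → Mark i m → Mark i m′ → WalkIn G (part T i) m m′ → d m ≡ d m′
    marks (inj₁ refl) (inj₁ refl) w = refl
    marks (inj₂ refl) (inj₂ refl) w = refl
    marks {i} (inj₁ refl) (inj₂ refl) w with a i ≟ b i
    ... | yes eq = cong d eq
    ... | no ne  = d-J i (ne , w)
    marks {i} (inj₂ refl) (inj₁ refl) w with a i ≟ b i
    ... | yes eq = cong d (sym eq)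
    ... | no ne  = sym (d-J i (ne , walk-sym (T-part-closed i) w))

    ToMark : Fin k → Fin V → Set
    ToMark i w = ∃ λ m → Mark i m × WalkIn G (part T i) w m × d m ≡ d v

    -- Induction on the rest of the walk to `v`: at an unramified vertex a piece is still open, and
    -- the claim records the mark at which it will end.
    along : ∀ {w} es → Chain G w es v → All (_∈ T) es →
            (ram w → d w ≡ d v) × (¬ ram w → ∀ e → o e ≡ w → ToMark (sg e) w)
    along []       refl       []         = (λ _ → refl) , λ ¬r → ⊥-elim (¬r rv)
    along (f ∷ es) (refl , c) (f∈ ∷ es∈) = ramified , unramified
      where
      IH = along es c es∈
      from-t : Dec (ram (t f)) → ToMark (sg f) (t f)
      from-t (yes r) = t f , subst₂ Mark (sg-bar f) (o-bar f) (sg-end (bar f) (subst ram (sym (o-bar f)) r)) ,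
                       walk-refl , proj₁ IH r
      from-t (no ¬r) = subst (λ i → ToMark i (t f)) (sg-bar f) (proj₂ IH ¬r (bar f) (o-bar f))
      from-o : ToMark (sg f) (o f)
      from-o = let m , mk , w , eq = from-t (ram? (t f))
               in m , mk , walk-trans (walk-edge f (part⁺ f∈ refl)) w , eq
      ramified : ram (o f) → d (o f) ≡ d v
      ramified r = let m , mk , w , eq = from-o in trans (marks (sg-end f r) mk w) eq
      unramified : ¬ ram (o f) → ∀ e → o e ≡ o f → ToMark (sg e) (o f)
      unramified ¬r e eq = subst (λ i → ToMark i (o f)) (sg-at (sym eq) ¬r) from-o

  -- Over 𝔽₂, potentials on the ramified vertices correspond to a constant
  -- together with a coboundary on the joined segments; hence 2 ^ l = 2 * 2 ^ #J.
  module _ {l : ℕ} (En : Enum ram l) {r₀ : Fin V} (ram-r₀ : ram r₀) where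
    private
      module En = Enum En
      Dom : Bool × Vec Bool k → Set
      Dom (_ , x) = ⊤ × (∀ i → J i ⊎ lookup x i ≡ false)

      value : Bool × Vec Bool k → Fin V → Bool
      value (x₀ , x) v = x₀ xor potential (lookup x) v

      f : Bool × Vec Bool k → Vec Bool l
      f x = tabulate (value x ∘ En.enum)

      value-δ : ∀ x i → J i → value x (a i) xor value x (b i) ≡ lookup (proj₂ x) i
      value-δ (x₀ , x) i j = trans (xor-cancel₀ x₀ _ _) (potential-δ (lookup x) i j)

      f-value : ∀ {x y} → f x ≡ f y → ∀ {v} → ram v → value x v ≡ value y v
      f-value {x} {y} eq r with En.complete r
      ... | i , refl = trans (sym (lookup∘tabulate _ i)) (trans (cong (λ c → lookup c i) eq) (lookup∘tabulate _ i))

      f-inj : ∀ {x y} → Dom x → Dom y → f x ≡ f y → x ≡ y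
      f-inj {x₀ , x} {y₀ , y} (_ , dx) (_ , dy) eq =
        cong₂ _,_ (trans (sym (xor-cancelʳ x₀ _))
                    (trans (cong₂ _xor_ (f-value {x₀ , x} {y₀ , y} eq ram-r₀)
                                        (cong (λ x → potential (lookup x) r₀) x≡y))
                      (xor-cancelʳ y₀ _))) x≡y
        where
        at : ∀ i → lookup x i ≡ lookup y i
        at i with J? i
        ... | yes j = trans (sym (value-δ (x₀ , x) i j))
                (trans (cong₂ _xor_ (f-value {x₀ , x} {y₀ , y} eq (ram-a i)) (f-value {x₀ , x} {y₀ , y} eq (ram-b i)))
                       (value-δ (y₀ , y) i j))
        ... | no ¬j = trans (off (dx i)) (sym (off (dy i)))
          where
          off : ∀ {z} → J i ⊎ z ≡ false → z ≡ false
          off = [ ⊥-elim ∘ ¬j , id ]′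
        x≡y = lookup-ext at

      f-surj : ∀ (c : Vec Bool l) → ∃ λ x → Dom x × f x ≡ c
      f-surj c = (x₀ , x) , (tt , dom) ,
        trans (tabulate-cong eq) (tabulate∘lookup c)
        where
        cv′ : ∀ {v} → Dec (ram v) → Bool
        cv′ (yes r) = lookup c (proj₁ (En.complete r))
        cv′ (no _)  = false
        cv : Fin V → Bool
        cv v = cv′ (ram? v)
        cv-enum : ∀ i → cv (En.enum i) ≡ lookup c i
        cv-enum i with ram? (En.enum i)
        ... | yes r = cong (lookup c) (En.inj (proj₂ (En.complete r)))
        ... | no ¬r = ⊥-elim (¬r (En.sound i))
        δ : Fin k → Bool
        δ i = if does (J? i) then cv (a i) xor cv (b i) else false
        x = tabulate δ
        dom : ∀ i → J i ⊎ lookup x i ≡ false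
        dom i = [ inj₁ , (λ ¬j → inj₂ (trans (lookup∘tabulate δ i) (if-no (J? i) ¬j))) ]′ (toSum (J? i))
        δ-J : ∀ i → J i → lookup x i ≡ cv (a i) xor cv (b i)
        δ-J i j = trans (lookup∘tabulate δ i) (if-yes (J? i) j)
        pot = potential (lookup x)
        -- `cv` and its potential jump alike across every joined segment, so their difference is
        -- constant on the ramified vertices; this constant is `x₀`.
        d : Fin V → Bool
        d v = cv v xor pot v
        xor-≡ : ∀ {y z} → y xor z ≡ false → y ≡ z
        xor-≡ {true}  {true}  _ = refl
        xor-≡ {false} {false} _ = refl
        d-J : ∀ i → J i → d (a i) ≡ d (b i)
        d-J i j = xor-≡ (trans (xor-interchange (cv (a i)) _ (cv (b i)) _)
          (trans (cong₂ _xor_ (sym (δ-J i j)) (potential-δ (lookup x) i j)) (xor-same (lookup x i))))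
        x₀ = d r₀
        eq : ∀ i → value (x₀ , x) (En.enum i) ≡ lookup c i
        eq i = trans (cong (_xor pot (En.enum i)) (constant d d-J ram-r₀ (En.sound i)))
                 (trans (xor-cancelʳ (cv (En.enum i)) _) (cv-enum i))

    joined-count : suc (trues k (does ∘ J?)) ≡ l
    joined-count = 2^-injective (trans (cong (2 *_) (sym (prodFin-if k (does ∘ J?) 2)))
      (trans (enum-unique all-by-f all) (prodFin-const l 2)))
      where
      All⊤ : Vec Bool l → Set
      All⊤ v = ∀ i → ⊤
      all : Enum All⊤ (prodFin l (λ _ → 2))
      all = enum-Vec l (λ _ → enum-Bool (λ _ → tt))
      dom : Enum Dom (2 * prodFin k (λ i → if does (J? i) then 2 else 1))
      dom = enum-Σ {P = λ _ → ⊤} {Q = λ _ x → ∀ i → J i ⊎ lookup x i ≡ false} (enum-Bool (λ _ → tt))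
              (λ _ → enum-Vec k (λ i → enum-⊎≡ (J? i) false enum-Bool))
      all-by-f : Enum All⊤ (2 * prodFin k (λ i → if does (J? i) then 2 else 1))
      all-by-f = enum-map dom f (λ _ _ → tt) f-inj (λ {c} _ → f-surj c)

    prod-joined : ∀ q → prodFin k (λ i → if does (J? i) then q else 1) ≡ q ^ (l ∸ 1)
    prod-joined q = trans (prodFin-if k (does ∘ J?) q) (cong (λ l → q ^ (l ∸ 1)) joined-count)

-- Counting codes over the spanning trees of X

module TreeCount {V E : ℕ} (X : FinGraph V E) (isG : IsGraph X) (ram : Fin V → Set)
                 (Sg : Segmentation X ram) (q : ℕ) (g₀ : Fin q) (Fb : Fibres V ram q)
                 (walk? : ∀ S u v → Dec (WalkIn (toPre X) S u v)) where
  open Segmentation Sg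
  open Cover X isG ram Sg q g₀ Fb

  enum-segCode : ∀ T′ i {f} → Enum (Forest i) f → ∀ g h →
                 Enum (SegCode T′ i g h) (if does (h ≟ g) then 1 else f)
  enum-segCode T′ i En g h with h ≟ g
  ... | yes h≡g = enum-iff (λ eq → (λ _ → eq) , λ h≢g → ⊥-elim (h≢g h≡g)) (λ p → proj₁ p h≡g) (enum-≡ (part T′ i))
  ... | no h≢g  = enum-iff (λ Fo → (λ h≡g → ⊥-elim (h≢g h≡g)) , λ _ → Fo) (λ p → proj₂ p h≢g) En

  enum-cover : ∀ {l κ} {F : Fin k → ℕ} {r₀} → ram r₀ → Enum ram l → (∀ i → Enum (Forest i) (F i)) →
               Enum (SpanningTree G) κ →
               Enum (SpanningTree Y) (κ * (q ^ (l ∸ 1) * prodFin k (λ i → F i ^ (q ∸ 1))))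
  enum-cover {l} {κ} {F} ram-r₀ En EnF EnT =
    enum-map (enum-Σ {Q = λ T′ c → ∀ i → ValidAt T′ i (lookup c i)} EnT (λ {T′} tree → fibre T′ tree)) decode
      (λ {c} → decode-tree c) (λ {c} {d} → decode-injective c d)
      (λ {T} tree → let open Encode walk? ram-r₀ T tree in code , code-valid , decode-code)
    where
    fibre : ∀ T′ → SpanningTree G T′ → Enum (λ c → ∀ i → ValidAt T′ i (lookup c i))
                                            (q ^ (l ∸ 1) * prodFin k (λ i → F i ^ (q ∸ 1)))
    fibre T′ tree = subst (Enum _)
      (trans (prodFin-* k _ _) (cong (_* prodFin k _) (prod-joined En ram-r₀ q)))
      (enum-Vec k λ i → enum-Σ {Q = λ g s → ∀ h → SegCode T′ i g h (lookup s h)}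
        (enum-⊎≡ (J? i) g₀ enum-Fin)
        (λ {g} _ → subst (Enum _) (prodFin-except g (F i)) (enum-Vec q (enum-segCode T′ i (EnF i) g))))
      where open TreeCut X isG ram Sg walk? T′ tree

-- The layers of the tower as covers

ramified? : ∀ I → Dec (Ramified I)
ramified? triv     = no λ r → r refl
ramified? (pPow m) = yes λ ()

module LayerFibres (p : ℕ) (pr : Prime p) (n : ℕ) where
  private instance
    nzp : NonZero p
    nzp = prime⇒nonZero pr

  toℕ-mod : ∀ m d .{{_ : NonZero d}} → m < d → toℕ (m mod d) ≡ m
  toℕ-mod m d m<d = trans (toℕ-fromℕ< _) (m<n⇒m%n≡m m<d)

  rep : ∀ I → Fin (cosetSize p n I) → Fin (p ^ n)
  rep triv     c = c
  rep (pPow m) c = inject≤ c (ℕ.^-monoʳ-≤ p (ℕ.m⊓n≤n m n))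

  coset-rep : ∀ I c → coset p pr n I (rep I c) ≡ c
  coset-rep triv     c = toℕ-injective (toℕ-mod _ (p ^ n) {{ℕ.m^n≢0 p n}} (toℕ<n c))
  coset-rep (pPow m) c = toℕ-injective (trans
    (cong (λ x → toℕ (_mod_ x (p ^ (m ⊓ n)) {{ℕ.m^n≢0 p (m ⊓ n)}})) (toℕ-inject≤ c _))
    (toℕ-mod _ (p ^ (m ⊓ n)) {{ℕ.m^n≢0 p (m ⊓ n)}} (toℕ<n c)))

  rep-coset : ∀ I g → ¬ Ramified I → rep I (coset p pr n I g) ≡ g
  rep-coset triv     g _  = coset-rep triv g
  rep-coset (pPow m) g ¬r = ⊥-elim (¬r λ ())

  coset-total : ∀ I g h → TotallyRamified I → coset p pr n I g ≡ coset p pr n I h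
  -- `p ^ (0 ⊓ n)` computes to 1, so there is a single coset.
  coset-total .(pPow 0) g h refl = one _ _
    where
    one : (i j : Fin 1) → i ≡ j
    one zero zero = refl

  fibres : ∀ {V} (I : Fin V → CSub) → (∀ v → Ramified (I v) → TotallyRamified (I v)) →
           Fibres V (λ v → Ramified (I v)) (p ^ n)
  fibres {V} I total = record
    { Vtx = Σ (Fin V) λ v → Fin (cosetSize p n (I v))
    ; pt = λ v g → v , coset p pr n (I v) g
    ; base = proj₁
    ; sheet = λ y → rep (I (proj₁ y)) (proj₂ y)
    ; pt-surj = λ y → cong (proj₁ y ,_) (coset-rep (I (proj₁ y)) (proj₂ y))
    ; base-pt = λ v g → refl
    ; sheet-pt = λ {v} g ¬r → rep-coset (I v) g ¬r
    ; pt-ram = λ {v} g h r → cong (v ,_) (coset-total (I v) g h (total v r)) }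

  sheet₀ : Fin (p ^ n)
  sheet₀ = fromℕ< (ℕ.m^n>0 p n)

-- These two elements of Γ₁ give an unramified vertex two distinct points in the first layer.
two-sheets : ∀ p → Prime p → Σ (Fin (p ^ 1)) λ g → Σ (Fin (p ^ 1)) λ h → g ≢ h
two-sheets zero          pr = ⊥-elim (¬prime[0] pr)
two-sheets (suc zero)    pr = ⊥-elim (¬prime[1] pr)
two-sheets (suc (suc p)) pr = zero , suc zero , λ ()

module FromDecomp {V E : ℕ} (X : FinGraph V E) (isG : IsGraph X) (ram : Fin V → Set)
                  (ram? : ∀ v → Dec (ram v)) (D : Segments.SegDecomp (toPre X) ram)
                  (edge2? : ∀ e → Dec (Segments.EdgeIn2Seg (toPre X) ram e))
                  (out : ∀ v → ¬ ram v → ∃ λ e → FinGraph.o X e ≡ v) where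
  open Segments (toPre X) ram
  open SegDecomp D
  open Ears X isG ram ram?
  open Decomp D edge2?

  segmentation : Segmentation X ram
  segmentation = record
    { ram? = ram? ; k = k ; sg = segOf ; sg-bar = segOf-bar ; sg-at = segOf-at
    ; a = end₁ ∘ seg ; b = end₂ ∘ seg
    ; ram-a = λ i → proj₁ (ram-ends (seg i) (valid i))
    ; ram-b = λ i → proj₂ (ram-ends (seg i) (valid i))
    ; sg-end = segOf-end ; out = out }

  open Segmentation segmentation using (Forest)

  segForest⇒forest : ∀ {i F} → SegForest (seg i) F → Forest i F
  segForest⇒forest {i} (ins , cl , acy , sp , sep) = record
    { inside = λ e∈ → segOf-unique (ins _ e∈) ; closed = cl ; acyclic = acy
    ; spans = λ { e refl → let m , mk , w = sp _ edge⇒segVert in m , marked⇒end (seg i) mk , w }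
    ; separated = λ mk mk′ → sep _ _ (end⇒marked (seg i) mk) (end⇒marked (seg i) mk′) }

  forest⇒segForest : ∀ {i F} → Forest i F → SegForest (seg i) F
  forest⇒segForest {i} {F} Fo =
    (λ e e∈ → subst (λ i → SegEdge (seg i) e) (Fo.inside e∈) (segOf-sound e)) , Fo.closed , Fo.acyclic , sp ,
    λ m m′ mk mk′ → Fo.separated (marked⇒end (seg i) mk) (marked⇒end (seg i) mk′)
    where
    module Fo = Forest Fo
    sp : ∀ w → SegVert (seg i) w → Σ (Fin V) λ m → Marked (seg i) m × WalkIn (toPre X) F w m
    sp w sv with segVert⇒edge sv
    ... | e , refl , eq = let m , mk , wk = Fo.spans e eq in m , end⇒marked (seg i) mk , wk

theorem5p12 : (p : ℕ) (pr : Prime p) {V E : ℕ} (X : FinGraph V E) → IsGraph X →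
    (I : Fin V → CSub) →
    GraphConnected (toPre X) →
    NoTails (toPre X) (λ v → Ramified (I v)) →
    (∀ n → GraphConnected (Layer p pr X I n)) →
    (∀ v → Ramified (I v) → TotallyRamified (I v)) →
    (l : ℕ) → IsCount (λ v → Ramified (I v)) l →
    (D : Segments.SegDecomp (toPre X) (λ v → Ramified (I v))) →
    (F : Fin (Segments.SegDecomp.k D) → ℕ) →
    (∀ i → IsCount (Segments.SegForest (toPre X) (λ v → Ramified (I v))
    (Segments.SegDecomp.seg D i)) (F i)) →
    (κX : ℕ) → IsCount (SpanningTree (toPre X)) κX →
    (n κn : ℕ) → IsCount (SpanningTree (Layer p pr X I n)) κn →
    κn ≡ κX * p ^ (n * (l ∸ 1))
    * prodFin (Segments.SegDecomp.k D) (λ i → F i ^ (p ^ n ∸ 1))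
theorem5p12 p pr {V} {E} X isG I conn _ connₙ total l cl D F cF κX cX n κn cn =
  -- The goal is stable, so walks and 2-segments may be assumed decidable.
  decidable-stable (_ ℕ.≟ _) λ ne →
  ¬¬-Subset (λ S → ¬¬-Fin λ u → ¬¬-Fin λ v → ¬¬-excluded-middle {A = WalkIn (toPre X) S u v}) λ walk? →
  ¬¬-Fin (λ e → ¬¬-excluded-middle {A = Segments.EdgeIn2Seg (toPre X) ram e}) λ edge2? →
  ne (formula walk? edge2?)
  where
  ram : Fin V → Set
  ram v = Ramified (I v)
  ram? : ∀ v → Dec (ram v)
  ram? v = ramified? (I v)
  open FinGraph X

  formula : (∀ S u v → Dec (WalkIn (toPre X) S u v)) → (∀ e → Dec (Segments.EdgeIn2Seg (toPre X) ram e)) →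
            κn ≡ κX * p ^ (n * (l ∸ 1)) * prodFin (Segments.SegDecomp.k D) (λ i → F i ^ (p ^ n ∸ 1))
  formula walk? edge2? = trans (enum-unique (enum-count cn) (enum-cover (proj₂ root) (enum-count cl)
      (λ i → enum-iff segForest⇒forest forest⇒segForest (enum-count (cF i))) (enum-count cX)))
    (trans (sym (ℕ.*-assoc κX _ _))
      (cong (λ x → κX * x * prodFin (Segments.SegDecomp.k D) (λ i → F i ^ (p ^ n ∸ 1))) (ℕ.^-*-assoc p n (l ∸ 1))))
    where
    -- If `v` is unramified, a walk between two distinct points above it in the first layer provides
    -- an edge of X. That edge lies on a path of the decomposition, whose ends are ramified.
    root : ∃ ram
    root with two-sheets p pr | proj₁ conn
    ... | g , h , g≢h | v with proj₂ (connₙ 1) (v , coset p pr 1 (I v) g) (v , coset p pr 1 (I v) h) | ram? v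
    ...   | _ | yes r = v , r
    ...   | x ∷ _ , _ | no _ = Ears.Decomp.ram-exists X isG ram ram? D edge2? (proj₁ (remQuot {E} (p ^ 1) x))
    ...   | [] , eq | no ¬r = ⊥-elim (g≢h (trans (sym (rep-coset (I v) g ¬r)) (trans (cong sheet eq) (rep-coset (I v) h ¬r))))
      where
      open LayerFibres p pr 1
      open Fibres (fibres I total)

    out : ∀ v → ¬ ram v → ∃ λ e → o e ≡ v
    out v ¬r with proj₂ conn v (proj₁ root)
    ... | []    , eq     = ⊥-elim (¬r (subst ram (sym eq) (proj₂ root)))
    ... | e ∷ _ , eq , _ = e , eq

    open FromDecomp X isG ram ram? D edge2? out
    open LayerFibres p pr n
    open TreeCount X isG ram segmentation (p ^ n) sheet₀ (fibres I total) walk?
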